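{- Let $S$ be a connected compact surface (closed, or with boundary) with a simplicial triangulation $T$ (so any two vertices span at most one edge), and let $\mathbf{d}_1,\mathbf{d}_2$ be two Euclidean polyhedral metrics on $(S,T)$, i.e. $(S,T,\mathbf{d}_1)$ and $(S,T,\mathbf{d}_2)$ are Euclidean polyhedral surfaces. Let $L_1,L_2$ be their discrete Laplace matrices. Then $L_1=L_2$ if and only if there is a constant $c>0$ with $\mathbf{d}_2=c\,\mathbf{d}_1$ (i.e. every edge length is multiplied by the same factor $c$).
   Context: An Euclidean polyhedral surface is a triple $(S,T,\mathbf{d})$ where $S$ is a surface, $T$ a triangulation of $S$ with vertices $v_1,\dots,v_N$, edges $e_1,\dots,e_m$ and faces $F$, and $\mathbf{d}$ is a metric on $S$ whose restriction to each triangle is isometric to a Euclidean triangle; equivalently $\mathbf{d}$ is given by edge lengths $d_k=d(e_k)>0$ satisfying the strict triangle inequalities on every face. Cotangent edge weight: if $[v_i,v_j]$ is a boundary edge lying in the single triangle $[v_i,v_j,v_k]$ and $\alpha$ is the angle at $v_k$, then $w_{ij}=\tfrac12\cot\alpha$; if $[v_i,v_j]$ is an interior edge and $\alpha,\beta$ are the two angles opposite to it in the two adjacent triangles, then $w_{ij}=\tfrac12(\cot\alpha+\cot\beta)$; $w_{ij}=0$ if $v_i,v_j$ are not joined by an edge. The discrete Laplace matrix $L=(L_{ij})$ is the $N\times N$ matrix with $L_{ij}=-w_{ij}$ for $i\neq j$ and $L_{ii}=\sum_k w_{ik}$. -}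

module Defs where

open import Level using (Level; _⊔_) renaming (suc to lsuc)
open import Algebra.Apartness.Bundles using (HeytingField)
import Algebra.Apartness.Properties.HeytingCommutativeRing as HCRProperties
open import Algebra.Bundles using (CommutativeRing)
open import Algebra.Bundles.Raw using (RawRing)
import Algebra.Definitions.RawMonoid as RawMonoidDefs
import Algebra.Properties.AbelianGroup as AbelianGroupProperties
import Algebra.Properties.Semiring.Mult as SemiringMult
import Algebra.Properties.Ring as RingProperties
import Algebra.Solver.Ring as RingSolver
import Algebra.Solver.Ring.AlmostCommutativeRing as ACR
open import Data.Empty using (⊥-elim)
open import Data.Fin.Base using (Fin)
open import Data.Fin.Properties using (_≟_)
open import Data.List.Base using (List; []; _∷_; [_]; _++_; length)
open import Data.List.Relation.Unary.Unique.Propositional using (Unique)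
open import Data.Maybe.Base using (Maybe; just; nothing)
open import Data.Nat.Base as ℕ using (ℕ; zero; suc; NonZero)
import Data.Nat.Properties as ℕ
open import Data.Product.Base using (∃; ∃₂; _×_; _,_; proj₁; proj₂)
open import Data.Sum.Base as Sum using (_⊎_; inj₁; inj₂)
open import Function.Base using (id)
open import Function.Bundles using (_⇔_; Equivalence)
open import Relation.Binary.Construct.Closure.ReflexiveTransitive using (Star)
open import Relation.Binary.Core using (Rel)
open import Relation.Binary.PropositionalEquality.Core as ≡ using (_≡_; _≢_)
open import Relation.Binary.Structures using (IsStrictPartialOrder)
open import Relation.Nullary using (¬_; yes; no)

------------------------------------------------------------------------

-- The standard library has no real numbers, so they are described
-- axiomatically, as an Archimedean, Cauchy complete ordered field.  This
-- determines ℝ up to isomorphism.  The order is only asked to be total in the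
-- constructive sense that x # y holds exactly when x < y or y < x (# being a
-- tight, cotransitive apartness), so that the axioms hold both for the
-- classical reals and for Bishop's.

record RealNumbers c ℓ₁ ℓ₂ ℓ₃ : Set (lsuc (c ⊔ ℓ₁ ⊔ ℓ₂ ⊔ ℓ₃)) where
  field
    heytingField : HeytingField c ℓ₁ ℓ₂

  open HeytingField heytingField public

  commutativeRing : CommutativeRing c ℓ₁
  commutativeRing = record { isCommutativeRing = isCommutativeRing }

  open RawMonoidDefs (CommutativeRing.+-rawMonoid commutativeRing) public
    using (sum) renaming (_×_ to _·_)

  infix 4 _<_

  field
    _<_                    : Rel Carrier ℓ₃
    <-isStrictPartialOrder : IsStrictPartialOrder _≈_ _<_
    #⇔<⊎>                  : ∀ {x y} → x # y ⇔ (x < y ⊎ y < x)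
    +-monoˡ-<              : ∀ {x y} z → x < y → x + z < y + z
    *-pos                  : ∀ {x y} → 0# < x → 0# < y → 0# < x * y

  -- |x - y| < ε
  Within : Carrier → Carrier → Carrier → Set ℓ₃
  Within ε x y = x < y + ε × y < x + ε

  IsCauchy : (ℕ → Carrier) → Set (c ⊔ ℓ₃)
  IsCauchy s = ∀ ε → 0# < ε →
    ∃ λ M → ∀ m n → M ℕ.≤ m → M ℕ.≤ n → Within ε (s m) (s n)

  ConvergesTo : (ℕ → Carrier) → Carrier → Set (c ⊔ ℓ₃)
  ConvergesTo s l = ∀ ε → 0# < ε → ∃ λ M → ∀ m → M ℕ.≤ m → Within ε (s m) l

  field
    archimedean : ∀ x → ∃ λ n → x < n · 1#
    complete    : ∀ s → IsCauchy s → ∃ λ l → ConvergesTo s l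

------------------------------------------------------------------------
-- Ring solver coefficients (m , n) stand for the integers m - n.

module IntegerCoefficientSolver {c ℓ} (R : CommutativeRing c ℓ) where

  open CommutativeRing R
  open SemiringMult semiring using (×1-homo-*) renaming (_×_ to _·_; ×-homo-+ to ·-homo-+)
  open RingProperties ring
  open AbelianGroupProperties +-abelianGroup using (⁻¹-∙-comm)
  open import Relation.Binary.Reasoning.Setoid setoid

  private
    normalise : ℕ → ℕ → ℕ × ℕ
    normalise (suc m) (suc n) = normalise m n
    normalise m       n       = m , n

    coefficients : RawRing _ _
    coefficients = record
      { Carrier = ℕ × ℕ
      ; _≈_     = _≡_
      ; _+_     = λ (m , n) (p , q) → normalise (m ℕ.+ p) (n ℕ.+ q)
      ; _*_     = λ (m , n) (p , q) → normalise (m ℕ.* p ℕ.+ n ℕ.* q) (m ℕ.* q ℕ.+ n ℕ.* p)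
      ; -_      = λ (m , n) → n , m
      ; 0#      = 0 , 0
      ; 1#      = 1 , 0
      }

    interchange : ∀ a b x y → (a + b) + (x + y) ≈ (a + x) + (b + y)
    interchange a b x y = begin
      (a + b) + (x + y) ≈⟨ +-assoc a b (x + y) ⟩
      a + (b + (x + y)) ≈⟨ +-congˡ (sym (+-assoc b x y)) ⟩
      a + ((b + x) + y) ≈⟨ +-congˡ (+-congʳ (+-comm b x)) ⟩
      a + ((x + b) + y) ≈⟨ +-congˡ (+-assoc x b y) ⟩
      a + (x + (b + y)) ≈⟨ sym (+-assoc a x (b + y)) ⟩
      (a + x) + (b + y) ∎

    +-lemma : ∀ a b x y → (a + x) - (b + y) ≈ (a - b) + (x - y)
    +-lemma a b x y = begin
      (a + x) - (b + y)     ≈⟨ +-congˡ (sym (⁻¹-∙-comm b y)) ⟩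
      (a + x) + (- b - y)   ≈⟨ interchange a x (- b) (- y) ⟩
      (a - b) + (x - y)     ∎

    *-lemma : ∀ a b x y → (a * x + b * y) - (a * y + b * x) ≈ (a - b) * (x - y)
    *-lemma a b x y = sym (begin
      (a - b) * (x - y)
        ≈⟨ distribʳ (x - y) a (- b) ⟩
      a * (x - y) + - b * (x - y)
        ≈⟨ +-cong (distribˡ a x (- y)) (distribˡ (- b) x (- y)) ⟩
      (a * x + a * - y) + (- b * x + - b * - y)
        ≈⟨ +-congˡ (+-comm (- b * x) (- b * - y)) ⟩
      (a * x + a * - y) + (- b * - y + - b * x)
        ≈⟨ interchange (a * x) (a * - y) (- b * - y) (- b * x) ⟩
      (a * x + - b * - y) + (a * - y + - b * x)
        ≈⟨ +-cong (+-congˡ b*y) (+-cong (sym (-‿distribʳ-* a y)) (sym (-‿distribˡ-* b x))) ⟩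
      (a * x + b * y) + (- (a * y) - (b * x))
        ≈⟨ +-congˡ (⁻¹-∙-comm (a * y) (b * x)) ⟩
      (a * x + b * y) - (a * y + b * x) ∎)
      where
      b*y : - b * - y ≈ b * y
      b*y = begin
        - b * - y     ≈⟨ sym (-‿distribˡ-* b (- y)) ⟩
        - (b * - y)   ≈⟨ -‿cong (sym (-‿distribʳ-* b y)) ⟩
        - (- (b * y)) ≈⟨ -‿involutive (b * y) ⟩
        b * y         ∎

    ⟦_⟧ᶜ : ℕ × ℕ → Carrier
    ⟦ m , n ⟧ᶜ = m · 1# - n · 1#

    normalise-≈ : ∀ m n → ⟦ normalise m n ⟧ᶜ ≈ m · 1# - n · 1#
    normalise-≈ zero    n       = refl
    normalise-≈ (suc m) zero    = refl
    normalise-≈ (suc m) (suc n) = begin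
      ⟦ normalise m n ⟧ᶜ               ≈⟨ normalise-≈ m n ⟩
      m · 1# - n · 1#                  ≈⟨ sym (+-identityˡ _) ⟩
      0# + (m · 1# - n · 1#)           ≈⟨ +-congʳ (sym (-‿inverseʳ 1#)) ⟩
      (1# - 1#) + (m · 1# - n · 1#)    ≈⟨ sym (+-lemma 1# 1# (m · 1#) (n · 1#)) ⟩
      (1# + m · 1#) - (1# + n · 1#)    ∎

    morphism : coefficients ACR.-Raw-AlmostCommutative⟶ ACR.fromCommutativeRing R
    morphism = record
      { ⟦_⟧    = ⟦_⟧ᶜ
      ; +-homo = λ (m , n) (p , q) → begin
          ⟦ normalise (m ℕ.+ p) (n ℕ.+ q) ⟧ᶜ
            ≈⟨ normalise-≈ (m ℕ.+ p) (n ℕ.+ q) ⟩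
          (m ℕ.+ p) · 1# - (n ℕ.+ q) · 1#
            ≈⟨ +-cong (·-homo-+ 1# m p) (-‿cong (·-homo-+ 1# n q)) ⟩
          (m · 1# + p · 1#) - (n · 1# + q · 1#)
            ≈⟨ +-lemma (m · 1#) (n · 1#) (p · 1#) (q · 1#) ⟩
          ⟦ m , n ⟧ᶜ + ⟦ p , q ⟧ᶜ ∎
      ; *-homo = λ (m , n) (p , q) → begin
          ⟦ normalise (m ℕ.* p ℕ.+ n ℕ.* q) (m ℕ.* q ℕ.+ n ℕ.* p) ⟧ᶜ
            ≈⟨ normalise-≈ (m ℕ.* p ℕ.+ n ℕ.* q) (m ℕ.* q ℕ.+ n ℕ.* p) ⟩
          (m ℕ.* p ℕ.+ n ℕ.* q) · 1# - (m ℕ.* q ℕ.+ n ℕ.* p) · 1#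
            ≈⟨ +-cong (products m p n q) (-‿cong (products m q n p)) ⟩
          _ ≈⟨ *-lemma (m · 1#) (n · 1#) (p · 1#) (q · 1#) ⟩
          ⟦ m , n ⟧ᶜ * ⟦ p , q ⟧ᶜ ∎
      ; -‿homo = λ (m , n) → begin
          n · 1# - m · 1#         ≈⟨ +-comm (n · 1#) (- (m · 1#)) ⟩
          - (m · 1#) + n · 1#     ≈⟨ +-congˡ (sym (-‿involutive (n · 1#))) ⟩
          - (m · 1#) - - (n · 1#) ≈⟨ ⁻¹-∙-comm (m · 1#) (- (n · 1#)) ⟩
          - (m · 1# - n · 1#)     ∎
      ; 0-homo = -‿inverseʳ 0#
      ; 1-homo = begin
          (1# + 0#) - 0# ≈⟨ +-assoc 1# 0# (- 0#) ⟩
          1# + (0# - 0#) ≈⟨ +-congˡ (-‿inverseʳ 0#) ⟩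
          1# + 0#        ≈⟨ +-identityʳ 1# ⟩
          1#             ∎
      }
      where
      products : ∀ m p n q →
        (m ℕ.* p ℕ.+ n ℕ.* q) · 1# ≈ (m · 1#) * (p · 1#) + (n · 1#) * (q · 1#)
      products m p n q = trans (·-homo-+ 1# (m ℕ.* p) (n ℕ.* q))
                               (+-cong (×1-homo-* m p) (×1-homo-* n q))

    ≈-lemma : ∀ a b x y → a + y ≈ x + b → a - b ≈ x - y
    ≈-lemma a b x y eq = begin
      a - b             ≈⟨ sym (+-identityʳ (a - b)) ⟩
      (a - b) + 0#      ≈⟨ +-congˡ (sym (-‿inverseʳ y)) ⟩
      (a - b) + (y - y) ≈⟨ interchange a (- b) y (- y) ⟩
      (a + y) + (- b - y) ≈⟨ +-cong eq (+-comm (- b) (- y)) ⟩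
      (x + b) + (- y - b) ≈⟨ interchange x b (- y) (- b) ⟩
      (x - y) + (b - b) ≈⟨ +-congˡ (-‿inverseʳ b) ⟩
      (x - y) + 0#      ≈⟨ +-identityʳ (x - y) ⟩
      x - y             ∎

    decide : ∀ r s → Maybe (⟦ r ⟧ᶜ ≈ ⟦ s ⟧ᶜ)
    decide (m , n) (p , q) with m ℕ.+ q ℕ.≟ p ℕ.+ n
    ... | no  _  = nothing
    ... | yes eq = just (≈-lemma (m · 1#) (n · 1#) (p · 1#) (q · 1#) (begin
      m · 1# + q · 1# ≈⟨ sym (·-homo-+ 1# m q) ⟩
      (m ℕ.+ q) · 1#  ≈⟨ reflexive (≡.cong (_· 1#) eq) ⟩
      (p ℕ.+ n) · 1#  ≈⟨ ·-homo-+ 1# p n ⟩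
      p · 1# + n · 1# ∎))

  open RingSolver coefficients (ACR.fromCommutativeRing R) morphism decide public

------------------------------------------------------------------------

module RealProperties {c ℓ₁ ℓ₂ ℓ₃} (ℝ : RealNumbers c ℓ₁ ℓ₂ ℓ₃) where

  open RealNumbers ℝ
  open HCRProperties heytingCommutativeRing using (1#0; invertibleˡ⇒#; x-0≈x)
  open IsStrictPartialOrder <-isStrictPartialOrder public
    using (<-respʳ-≈; <-respˡ-≈) renaming (irrefl to <-irrefl; trans to <-trans)
  open IntegerCoefficientSolver commutativeRing public
    using (solve; con; _:=_; _:+_; _:*_; _:-_; :-_)

  <-asym : ∀ {x y} → x < y → ¬ y < x
  <-asym x<y y<x = <-irrefl refl (<-trans x<y y<x)

  <-cotrans : ∀ {x y} → x < y → ∀ z → x < z ⊎ z < y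
  <-cotrans {x} {y} x<y z with #-cotrans (Equivalence.from #⇔<⊎> (inj₁ x<y)) z
  ... | inj₁ x#z with Equivalence.to #⇔<⊎> x#z
  ...   | inj₁ x<z = inj₁ x<z
  ...   | inj₂ z<x = inj₂ (<-trans z<x x<y)
  <-cotrans {x} {y} x<y z | inj₂ z#y with Equivalence.to #⇔<⊎> z#y
  ...   | inj₁ z<y = inj₂ z<y
  ...   | inj₂ y<z = inj₁ (<-trans x<y y<z)

  ≮∧≯⇒≈ : ∀ {x y} → ¬ x < y → ¬ y < x → x ≈ y
  ≮∧≯⇒≈ {x} {y} x≮y y≮x = proj₁ (tight x y) λ x#y → case (Equivalence.to #⇔<⊎> x#y)
    where
    case : ¬ (x < y ⊎ y < x)
    case (inj₁ x<y) = x≮y x<y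
    case (inj₂ y<x) = y≮x y<x

  x<y⇒0<y-x : ∀ {x y} → x < y → 0# < y - x
  x<y⇒0<y-x {x} x<y = <-respˡ-≈ (-‿inverseʳ x) (+-monoˡ-< (- x) x<y)

  0<y-x⇒x<y : ∀ {x y} → 0# < y - x → x < y
  0<y-x⇒x<y {x} {y} 0<y-x =
    <-respʳ-≈ (solve 2 (λ x y → (y :- x) :+ x := y) refl x y)
      (<-respˡ-≈ (+-identityˡ x) (+-monoˡ-< x 0<y-x))

  pos⇒< : ∀ {x y p} → p ≈ y - x → 0# < p → x < y
  pos⇒< p≈y-x 0<p = 0<y-x⇒x<y (<-respʳ-≈ p≈y-x 0<p)

  +-pos : ∀ {x y} → 0# < x → 0# < y → 0# < x + y
  +-pos {x} {y} 0<x 0<y =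
    <-trans 0<y (<-respˡ-≈ (+-identityˡ y) (+-monoˡ-< y 0<x))

  +-mono-< : ∀ {x y u v} → x < y → u < v → x + u < y + v
  +-mono-< {x} {y} {u} {v} x<y u<v = pos⇒<
    (solve 4 (λ x y u v → (y :- x) :+ (v :- u) := (y :+ v) :- (x :+ u)) refl x y u v)
    (+-pos (x<y⇒0<y-x x<y) (x<y⇒0<y-x u<v))

  *-monoˡ-< : ∀ {x y z} → 0# < z → x < y → z * x < z * y
  *-monoˡ-< {x} {y} {z} 0<z x<y = pos⇒<
    (solve 3 (λ x y z → z :* (y :- x) := z :* y :- z :* x) refl x y z)
    (*-pos 0<z (x<y⇒0<y-x x<y))

  x<x+pos : ∀ {x p} → 0# < p → x < x + p
  x<x+pos {x} {p} = pos⇒< (solve 2 (λ x p → p := (x :+ p) :- x) refl x p)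

  0<1 : 0# < 1#
  0<1 with Equivalence.to #⇔<⊎> 1#0
  ... | inj₂ 0<1# = 0<1#
  ... | inj₁ 1<0  = <-respʳ-≈ -1*-1 (*-pos 0<-1 0<-1)
    where
    0<-1 : 0# < 0# - 1#
    0<-1 = x<y⇒0<y-x 1<0
    -1*-1 : (0# - 1#) * (0# - 1#) ≈ 1#
    -1*-1 = trans (*-cong (+-identityˡ (- 1#)) (+-identityˡ (- 1#)))
      (trans (solve 1 (λ o → (:- o) :* (:- o) := o :* o) refl 1#) (*-identityˡ 1#))

  module _ {x} (0<x : 0# < x) where

    private
      inverse = #⇒invertible (Equivalence.from (#⇔<⊎> {x} {0#}) (inj₂ 0<x))

    recip : Carrier
    recip = proj₁ inverse

    recip-inverseˡ : recip * x ≈ 1#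
    recip-inverseˡ = trans (*-congˡ (sym (x-0≈x x))) (proj₁ (proj₂ inverse))

    recip-inverseʳ : x * recip ≈ 1#
    recip-inverseʳ = trans (*-comm x recip) recip-inverseˡ

    recip-pos : 0# < recip
    recip-pos with Equivalence.to #⇔<⊎> recip#0
      where
      recip#0 : recip # 0#
      recip#0 = invertibleˡ⇒# (x , trans (*-congˡ (x-0≈x recip)) recip-inverseʳ)
    ... | inj₂ 0<r = 0<r
    ... | inj₁ r<0 = ⊥-elim (<-asym 0<1 (pos⇒< eq (*-pos (x<y⇒0<y-x r<0) 0<x)))
      where
      eq : (0# - recip) * x ≈ 0# - 1#
      eq = trans
        (solve 3 (λ z r x → (z :- r) :* x := z :* x :- r :* x) refl 0# recip x)
        (+-cong (zeroˡ x) (-‿cong recip-inverseˡ))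

  2# : Carrier
  2# = 1# + 1#

  0<2 : 0# < 2#
  0<2 = +-pos 0<1 0<1

  ½ : Carrier
  ½ = recip 0<2

  0<½ : 0# < ½
  0<½ = recip-pos 0<2

  ½+½ : ½ + ½ ≈ 1#
  ½+½ = trans (+-cong (sym (*-identityʳ ½)) (sym (*-identityʳ ½)))
    (trans (sym (distribˡ ½ 1# 1#)) (recip-inverseˡ 0<2))

  ½x+½x : ∀ x → ½ * x + ½ * x ≈ x
  ½x+½x x = trans (sym (distribʳ x ½ ½)) (trans (*-congʳ ½+½) (*-identityˡ x))

  suc·1-pos : ∀ n → 0# < suc n · 1#
  suc·1-pos zero    = <-respʳ-≈ (sym (+-identityʳ 1#)) 0<1
  suc·1-pos (suc n) = +-pos 0<1 (suc·1-pos n)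

  -- Newton's iteration: x decreases and y = a / x increases to the square
  -- root of a.
  private
    module Newton {a} (0<a : 0# < a) where

      record State : Set (c ⊔ ℓ₁ ⊔ ℓ₃) where
        field
          x y : Carrier
          0<x : 0# < x
          0<y : 0# < y
          xy≈a : x * y ≈ a
          y<x  : y < x

        gap : Carrier
        gap = x - y

        0<gap : 0# < gap
        0<gap = x<y⇒0<y-x y<x

      open State

      module Step (s : State) where
        private
          module s = State s

        x′ y′ : Carrier
        x′ = ½ * (s.x + s.y)

        0<x′ : 0# < x′
        0<x′ = *-pos 0<½ (+-pos s.0<x s.0<y)

        y′ = a * recip 0<x′

        0<y′ : 0# < y′
        0<y′ = *-pos 0<a (recip-pos 0<x′)

        x′y′≈a : x′ * y′ ≈ a
        x′y′≈a = trans
          (solve 3 (λ x a r → x :* (a :* r) := (r :* x) :* a) refl x′ a (recip 0<x′))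
          (trans (*-congʳ (recip-inverseˡ 0<x′)) (*-identityˡ a))

        x-x′ : ½ * s.gap ≈ s.x - x′
        x-x′ = trans
          (solve 3 (λ h x y → h :* (x :- y) := (h :* x :+ h :* x) :- h :* (x :+ y))
            refl ½ s.x s.y)
          (+-congʳ (½x+½x s.x))

        0<½gap : 0# < ½ * s.gap
        0<½gap = *-pos 0<½ s.0<gap

        x′<x : x′ < s.x
        x′<x = pos⇒< x-x′ 0<½gap

        y′-y : s.y * (recip 0<x′ * (½ * s.gap)) ≈ y′ - s.y
        y′-y = trans (*-congˡ (*-congˡ x-x′)) (trans
          (solve 4 (λ x y r x′ → y :* (r :* (x :- x′)) := (x :* y) :* r :- (r :* x′) :* y)
            refl s.x s.y (recip 0<x′) x′)
          (+-cong (*-congʳ s.xy≈a)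
            (-‿cong (trans (*-congʳ (recip-inverseˡ 0<x′)) (*-identityˡ s.y)))))

        y<y′ : s.y < y′
        y<y′ = pos⇒< y′-y (*-pos s.0<y (*-pos (recip-pos 0<x′) 0<½gap))

        x′²-a : (½ * s.gap) * (½ * s.gap) ≈ x′ * x′ - a
        x′²-a = trans
          (solve 3 (λ h x y →
            (h :* (x :- y)) :* (h :* (x :- y)) :=
            (h :* (x :+ y)) :* (h :* (x :+ y)) :-
              (h :* (h :* (x :* y) :+ h :* (x :* y)) :+ h :* (h :* (x :* y) :+ h :* (x :* y))))
            refl ½ s.x s.y)
          (+-congˡ (-‿cong (trans (½x+½x _) (trans (½x+½x _) s.xy≈a))))

        x′-y′ : recip 0<x′ * ((½ * s.gap) * (½ * s.gap)) ≈ x′ - y′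
        x′-y′ = trans (*-congˡ x′²-a) (trans
          (solve 3 (λ r x a → r :* (x :* x :- a) := (r :* x) :* x :- a :* r)
            refl (recip 0<x′) x′ a)
          (+-congʳ (trans (*-congʳ (recip-inverseˡ 0<x′)) (*-identityˡ x′))))

        y′<x′ : y′ < x′
        y′<x′ = pos⇒< x′-y′ (*-pos (recip-pos 0<x′) (*-pos 0<½gap 0<½gap))

        step : State
        step = record { x = x′ ; y = y′ ; 0<x = 0<x′ ; 0<y = 0<y′ ; xy≈a = x′y′≈a ; y<x = y′<x′ }

        gap-halves : gap step < ½ * s.gap
        gap-halves = pos⇒<
          (trans (solve 2 (λ y y′ → y′ :- y := (:- y) :+ y′) refl s.y y′)
          (trans (+-congʳ (-‿cong (sym (½x+½x s.y))))
          (solve 4 (λ h x y y′ →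
            (:- (h :* y :+ h :* y)) :+ y′ := h :* (x :- y) :- (h :* (x :+ y) :- y′))
            refl ½ s.x s.y y′)))
          (x<y⇒0<y-x y<y′)

        gap-decreases : gap step < s.gap
        gap-decreases = <-trans gap-halves
          (<-respʳ-≈ (½x+½x s.gap) (x<x+pos 0<½gap))

      open Step using (step)

      iterate : ℕ → State → State
      iterate zero    s = s
      iterate (suc n) s = iterate n (step s)

      iterate-+ : ∀ k n s → iterate (k ℕ.+ n) s ≡ iterate n (iterate k s)
      iterate-+ zero    n s = ≡.refl
      iterate-+ (suc k) n s = iterate-+ k n (step s)

      y<x-later : ∀ n s → y s < x (iterate n s)
      y<x-later zero    s = y<x s
      y<x-later (suc n) s = <-trans (Step.y<y′ s) (y<x-later n (step s))

      x-later<x : ∀ n s → x (iterate (suc n) s) < x s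
      x-later<x zero    s = Step.x′<x s
      x-later<x (suc n) s = <-trans (x-later<x n (step s)) (Step.x′<x s)

      x-later<x+δ : ∀ {δ} → 0# < δ → ∀ n s → x (iterate n s) < x s + δ
      x-later<x+δ 0<δ zero    s = x<x+pos 0<δ
      x-later<x+δ 0<δ (suc n) s = <-trans (x-later<x n s) (x<x+pos 0<δ)

      gap-bound : ∀ {ε} → 0# < ε → ∀ n s → gap s < (suc n · 1#) * ε →
                  ∃ λ M → gap (iterate M s) < ε
      gap-bound {ε} 0<ε zero s gap< =
        0 , <-respʳ-≈ (trans (*-congʳ (+-identityʳ 1#)) (*-identityˡ ε)) gap<
      gap-bound {ε} 0<ε (suc n) s gap< =
        let M , p = gap-bound 0<ε n (step s) (bound n gap<) in suc M , p
        where
        bound : ∀ n → gap s < (suc (suc n) · 1#) * ε → gap (step s) < (suc n · 1#) * ε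
        bound zero gap< = <-trans (Step.gap-halves s)
          (<-respʳ-≈ eq (*-monoˡ-< 0<½ gap<))
          where
          eq : ½ * ((1# + (1# + 0#)) * ε) ≈ (1# + 0#) * ε
          eq = trans (*-congˡ (*-congʳ (+-congˡ (+-identityʳ 1#))))
            (trans (sym (*-assoc ½ 2# ε))
            (*-congʳ (trans (recip-inverseˡ 0<2) (sym (+-identityʳ 1#)))))
        bound (suc n) gap< = <-trans (Step.gap-halves s)
          (<-trans (*-monoˡ-< 0<½ gap<)
            (pos⇒< eq (*-pos (*-pos 0<½ (suc·1-pos n)) 0<ε)))
          where
          N = suc n · 1#
          eq : (½ * N) * ε ≈ (1# + N) * ε - ½ * ((1# + (1# + N)) * ε)
          eq = trans
            (solve 4 (λ h n e o →
              (h :* n) :* e :=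
              ((h :* o :+ h :* o) :+ (h :* n :+ h :* n)) :* e :- h :* ((o :+ (o :+ n)) :* e))
              refl ½ N ε 1#)
            (+-congʳ (*-congʳ (+-cong (½x+½x 1#) (½x+½x N))))

      small-gap : ∀ {ε} → 0# < ε → ∀ s → ∃ λ M → gap (iterate M s) < ε
      small-gap {ε} 0<ε s with archimedean (gap s * recip 0<ε)
      ... | zero  , gap/ε<0 = ⊥-elim (<-asym gap/ε<0 (*-pos (0<gap s) (recip-pos 0<ε)))
      ... | suc n , gap/ε<n = gap-bound 0<ε n s
        (<-respʳ-≈ (*-comm ε (suc n · 1#)) (<-respˡ-≈ eq (*-monoˡ-< 0<ε gap/ε<n)))
        where
        eq : ε * (gap s * recip 0<ε) ≈ gap s
        eq = trans
          (solve 3 (λ e g r → e :* (g :* r) := g :* (e :* r)) refl ε (gap s) (recip 0<ε))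
          (trans (*-congˡ (recip-inverseʳ 0<ε)) (*-identityʳ (gap s)))

      start : State
      start = record
        { x = 1# + a ; y = a * recip 0<1+a ; 0<x = 0<1+a
        ; 0<y = *-pos 0<a (recip-pos 0<1+a)
        ; xy≈a = trans
            (solve 3 (λ x a r → x :* (a :* r) := (r :* x) :* a) refl (1# + a) a (recip 0<1+a))
            (trans (*-congʳ (recip-inverseˡ 0<1+a)) (*-identityˡ a))
        ; y<x = pos⇒< eq (*-pos (recip-pos 0<1+a) (+-pos (+-pos 0<1 0<a) (*-pos 0<a 0<a)))
        }
        where
        0<1+a : 0# < 1# + a
        0<1+a = +-pos 0<1 0<a
        r = recip 0<1+a
        eq : r * ((1# + a) + a * a) ≈ (1# + a) - a * r
        eq = trans (*-congˡ (+-congʳ (+-cong (sym (*-identityˡ 1#)) (sym (*-identityˡ a)))))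
          (trans
          (solve 3 (λ r a o → r :* ((o :* o :+ o :* a) :+ a :* a) :=
              (r :* (o :+ a)) :* (o :+ a) :- (o :* a) :* r)
            refl r a 1#)
          (+-cong (trans (*-congʳ (recip-inverseˡ 0<1+a)) (*-identityˡ (1# + a)))
                  (-‿cong (*-congʳ (*-identityˡ a)))))

      xs : ℕ → Carrier
      xs n = x (iterate n start)

      later : ∀ {M m} → M ℕ.≤ m → ∃ λ k → iterate m start ≡ iterate k (iterate M start)
      later {M} {m} M≤m = m ℕ.∸ M ,
        ≡.trans (≡.cong (λ i → iterate i start) (≡.sym (ℕ.m+[n∸m]≡n M≤m)))
                (iterate-+ M (m ℕ.∸ M) start)

      isCauchy : IsCauchy xs
      isCauchy ε 0<ε = let M , gap<ε = small-gap 0<ε start in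
        M , λ m n M≤m M≤n → bound gap<ε M≤m M≤n , bound gap<ε M≤n M≤m
        where
        bound : ∀ {M m n} → gap (iterate M start) < ε → M ℕ.≤ m → M ℕ.≤ n → xs m < xs n + ε
        bound {M} gap<ε M≤m M≤n
          with k , eq ← later M≤m | l , eq′ ← later M≤n rewrite eq | eq′ =
          <-trans
            (<-respʳ-≈ (solve 3 (λ x y e → x :+ (e :- (x :- y)) := y :+ e) refl (x s) (y s) ε)
              (x-later<x+δ (x<y⇒0<y-x gap<ε) k s))
            (+-monoˡ-< ε (y<x-later l s))
          where s = iterate M start

      root : Carrier
      root = proj₁ (complete xs isCauchy)

      converges : ConvergesTo xs root
      converges = proj₂ (complete xs isCauchy)

      iterate-suc : ∀ n → iterate (suc n) start ≡ step (iterate n start)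
      iterate-suc n = ≡.trans (≡.cong (λ i → iterate i start) (ℕ.+-comm 1 n))
                              (iterate-+ n 1 start)

      x≮root : ∀ n → ¬ xs n < root
      x≮root n xn<root = <-asym
        (x-later<x (proj₁ later-m) (iterate n start)) (≡.subst (xs n <_) xm≡ xn<xm)
        where
        M : ℕ
        M = proj₁ (converges (root - xs n) (x<y⇒0<y-x xn<root))
        m : ℕ
        m = M ℕ.⊔ suc n
        root<xm+ε : root < xs m + (root - xs n)
        root<xm+ε = proj₂ (proj₂ (converges (root - xs n) (x<y⇒0<y-x xn<root)) m (ℕ.m≤m⊔n M (suc n)))
        shift : ∀ u v w → (u + (v - w)) - v ≈ u - w
        shift = solve 3 (λ u v w → (u :+ (v :- w)) :- v := u :- w) refl
        xn<xm : xs n < xs m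
        xn<xm = pos⇒< (shift (xs m) root (xs n)) (x<y⇒0<y-x root<xm+ε)
        later-m : ∃ λ k → iterate m start ≡ iterate k (iterate (suc n) start)
        later-m = later (ℕ.m≤n⊔m M (suc n))
        xm≡ : xs m ≡ x (iterate (suc (proj₁ later-m)) (iterate n start))
        xm≡ = ≡.cong x (≡.trans (proj₂ later-m)
          (≡.cong (iterate (proj₁ later-m)) (iterate-suc n)))

      root≮y : ∀ n → ¬ root < y (iterate n start)
      root≮y n root<yn = <-asym
        (y<x-later (proj₁ later-m) (iterate n start))
        (≡.subst (_< yn) (≡.cong x (proj₂ later-m)) xm<yn)
        where
        yn : Carrier
        yn = y (iterate n start)
        M : ℕ
        M = proj₁ (converges (yn - root) (x<y⇒0<y-x root<yn))
        m : ℕ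
        m = M ℕ.⊔ n
        shift : ∀ l y → l + (y - l) ≈ y
        shift = solve 2 (λ l y → l :+ (y :- l) := y) refl
        xm<yn : xs m < yn
        xm<yn = <-respʳ-≈ (shift root yn)
          (proj₁ (proj₂ (converges (yn - root) (x<y⇒0<y-x root<yn)) m (ℕ.m≤m⊔n M n)))
        later-m : ∃ λ k → iterate m start ≡ iterate k (iterate n start)
        later-m = later (ℕ.m≤n⊔m M n)

      root<x : ∀ n → root < xs n
      root<x n = Sum.[ (λ x<r → ⊥-elim (x≮root (suc n)
                     (≡.subst (λ s → x s < root) (≡.sym (iterate-suc n)) x<r)))
                 , id ]′ (<-cotrans (Step.x′<x (iterate n start)) root)

      y<root : ∀ n → y (iterate n start) < root
      y<root n = Sum.[ id
                 , (λ r<y → ⊥-elim (root≮y (suc n)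
                     (≡.subst (λ s → root < y s) (≡.sym (iterate-suc n)) r<y)))
                 ]′ (<-cotrans (Step.y<y′ (iterate n start)) root)

      0<root : 0# < root
      0<root = <-trans (0<y start) (y<root 0)

      root²<a+ : ∀ n → let s = iterate n start in root * root < a + root * gap s
      root²<a+ n = <-respʳ-≈ (+-congʳ (xy≈a s)) (<-trans (*-monoˡ-< 0<root (root<x n))
        (pos⇒<
          (solve 3 (λ l x y → y :* (x :- l) := (x :* y :+ l :* (x :- y)) :- l :* x)
            refl root (x s) (y s))
          (*-pos (0<y s) (x<y⇒0<y-x (root<x n)))))
        where
        s = iterate n start

      a<root²+ : ∀ n → let s = iterate n start in a < root * root + root * gap s
      a<root²+ n = <-respˡ-≈ (xy≈a s) (<-trans (*-monoˡ-< (0<x s) (y<root n))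
        (pos⇒<
          (solve 3 (λ l x y → l :* (l :- y) := (l :* l :+ l :* (x :- y)) :- x :* l)
            refl root (x s) (y s))
          (*-pos 0<root (x<y⇒0<y-x (y<root n)))))
        where
        s = iterate n start

      -- u < v + root · gap at every stage excludes v < u
      ≮-limit : ∀ {u v} → (∀ n → u < v + root * gap (iterate n start)) → ¬ v < u
      ≮-limit {u} {v} bound v<u =
        let n , gap<δ = small-gap (*-pos 0<δ (recip-pos 0<root)) start in
        <-asym (bound n) (<-respʳ-≈ eq
          (<-respˡ-≈ (+-comm _ v)
            (+-monoˡ-< v (*-monoˡ-< 0<root gap<δ))))
        where
        0<δ : 0# < u - v
        0<δ = x<y⇒0<y-x v<u
        eq : root * ((u - v) * recip 0<root) + v ≈ u
        eq = trans
          (+-congʳ (trans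
            (solve 3 (λ l d r → l :* (d :* r) := (l :* r) :* d) refl root (u - v) (recip 0<root))
            (trans (*-congʳ (recip-inverseʳ 0<root)) (*-identityˡ (u - v)))))
          (solve 2 (λ u v → (u :- v) :+ v := u) refl u v)

      root² : root * root ≈ a
      root² = ≮∧≯⇒≈ (≮-limit a<root²+) (≮-limit root²<a+)

  module _ {a} (0<a : 0# < a) where abstract

    sqrt : Carrier
    sqrt = Newton.root 0<a

    sqrt-pos : 0# < sqrt
    sqrt-pos = Newton.0<root 0<a

    sqrt² : sqrt * sqrt ≈ a
    sqrt² = Newton.root² 0<a

------------------------------------------------------------------------

module EuclideanTriangles {c ℓ₁ ℓ₂ ℓ₃} (ℝ : RealNumbers c ℓ₁ ℓ₂ ℓ₃) where

  open RealNumbers ℝ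
  open RealProperties ℝ

  record Triangle (a b c : Carrier) : Set ℓ₃ where
    field
      0<a   : 0# < a
      0<b   : 0# < b
      0<c   : 0# < c
      a<b+c : a < b + c
      b<c+a : b < c + a
      c<a+b : c < a + b

  -- The angle α opposite to the side a, an angle in (0,π), is represented by
  -- its cosine (law of cosines) and its sine, the positive square root of
  -- 1 - cos² α.
  module OppositeAngle {a b c} (t : Triangle a b c) where
    open Triangle t

    private
      0<2bc : 0# < 2# * (b * c)
      0<2bc = *-pos 0<2 (*-pos 0<b 0<c)

    cosα : Carrier
    cosα = (b * b + c * c - a * a) * recip 0<2bc

    0<1-cos²α : 0# < 1# - cosα * cosα
    0<1-cos²α = <-respʳ-≈ eq
      (*-pos (*-pos (*-pos (*-pos (+-pos (+-pos 0<a 0<b) 0<c)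
          (x<y⇒0<y-x a<b+c)) (x<y⇒0<y-x b<c+a)) (x<y⇒0<y-x c<a+b))
        (*-pos (recip-pos 0<2bc) (recip-pos 0<2bc)))
      where
      r = recip 0<2bc
      double : ∀ x → 2# * x ≈ x + x
      double x = trans (distribʳ x 1# 1#) (+-cong (*-identityˡ x) (*-identityˡ x))
      rq : r * (b * c + b * c) ≈ 1#
      rq = trans (*-congˡ (sym (double (b * c)))) (recip-inverseˡ 0<2bc)
      eq : (a + b + c) * (b + c - a) * (c + a - b) * (a + b - c) * (r * r) ≈ 1# - cosα * cosα
      eq = trans
        (solve 4 (λ a b c r →
          (a :+ b :+ c) :* (b :+ c :- a) :* (c :+ a :- b) :* (a :+ b :- c) :* (r :* r) :=
          (r :* (b :* c :+ b :* c)) :* (r :* (b :* c :+ b :* c)) :-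
            ((b :* b :+ c :* c :- a :* a) :* r) :* ((b :* b :+ c :* c :- a :* a) :* r))
          refl a b c r)
        (+-congʳ (trans (*-cong rq rq) (*-identityˡ 1#)))

    sinα : Carrier
    sinα = sqrt 0<1-cos²α

    cotα : Carrier
    cotα = cosα * recip {sinα} (sqrt-pos 0<1-cos²α)

------------------------------------------------------------------------

private
  variable
    a : Level
    A : Set a

data Consecutive {a} {A : Set a} : List A → A → A → Set a where
  here  : ∀ {x y xs} → Consecutive (x ∷ y ∷ xs) x y
  there : ∀ {x y z xs} → Consecutive xs x y → Consecutive (z ∷ xs) x y

Neighbours : List A → A → A → Set _
Neighbours xs x y = Consecutive xs x y ⊎ Consecutive xs y x

-- The graph with (symmetric) adjacency relation G is a path x₁ – … – xₙ with
-- n ≥ 2 distinct vertices, up to isolated points.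
IsArc : Rel A Level.zero → Set _
IsArc {A = A} G = ∃ λ (xs : List A) →
  2 ℕ.≤ length xs × Unique xs × (∀ x y → G x y ⇔ Neighbours xs x y)

-- The same for a cycle x₁ – … – xₙ – x₁ with n ≥ 3.
IsCircle : Rel A Level.zero → Set _
IsCircle {A = A} G = ∃₂ λ (x₁ : A) (xs : List A) →
  3 ℕ.≤ length (x₁ ∷ xs) × Unique (x₁ ∷ xs) ×
  (∀ x y → G x y ⇔ Neighbours (x₁ ∷ xs ++ [ x₁ ]) x y)

-- How many triangles contain a pair of vertices, when P is the set of third
-- vertices of such triangles.
data Incidence {N} (P : Fin N → Set) : Set where
  nonEdge  : ¬ ∃ P → Incidence P
  boundary : ∀ {k} → P k → (∀ m → P m → m ≡ k) → Incidence P
  interior : ∀ {k l} → P k → P l → k ≢ l → (∀ m → P m → m ≡ k ⊎ m ≡ l) → Incidence P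

-- A simplicial triangulation, with vertices Fin N, of a nonempty connected
-- compact surface.  It is a finite simplicial complex given by its triangles
-- (every simplex lies in one); that it triangulates a surface, possibly with
-- boundary, means that the link of each vertex v, whose edges are those [x,y]
-- with [v,x,y] a triangle, is a circle (v interior) or an arc (v on the
-- boundary).  Then every edge lies in one triangle (boundary edges) or in two
-- (interior edges); `incidence` records which.
record TriangulatedSurface (N : ℕ) : Set₁ where
  field
    Face          : Fin N → Fin N → Fin N → Set
    face-rotate   : ∀ {i j k} → Face i j k → Face j k i
    face-swap     : ∀ {i j k} → Face i j k → Face j i k
    face-distinct : ∀ {i j k} → Face i j k → i ≢ j

  Edge : Fin N → Fin N → Set
  Edge i j = ∃ λ k → Face i j k

  field
    incidence : ∀ i j → Incidence (Face i j)
    link      : ∀ v → IsCircle (Face v) ⊎ IsArc (Face v)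
    nonempty  : NonZero N
    connected : ∀ i j → Star Edge i j

------------------------------------------------------------------------

module Polyhedral {c ℓ₁ ℓ₂ ℓ₃} (ℝ : RealNumbers c ℓ₁ ℓ₂ ℓ₃)
                  {N : ℕ} (T : TriangulatedSurface N) where

  open RealNumbers ℝ
  open RealProperties ℝ
  open EuclideanTriangles ℝ
  open TriangulatedSurface T

  -- Edge lengths; the values of `edgeLength` on non-edges are irrelevant.
  record EuclideanMetric : Set (c ⊔ ℓ₁ ⊔ ℓ₃) where
    field
      edgeLength    : Fin N → Fin N → Carrier
      symmetric     : ∀ {i j} → Edge i j → edgeLength i j ≈ edgeLength j i
      positive      : ∀ {i j} → Edge i j → 0# < edgeLength i j
      triangle-ineq : ∀ {i j k} → Face i j k →
                      edgeLength i j < edgeLength j k + edgeLength k i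

    faceTriangle : ∀ {i j k} → Face i j k →
                   Triangle (edgeLength i j) (edgeLength j k) (edgeLength k i)
    faceTriangle {i} {j} {k} f = record
      { 0<a   = positive (k , f)
      ; 0<b   = positive (i , face-rotate f)
      ; 0<c   = positive (j , face-rotate (face-rotate f))
      ; a<b+c = triangle-ineq f
      ; b<c+a = triangle-ineq (face-rotate f)
      ; c<a+b = triangle-ineq (face-rotate (face-rotate f))
      }

    -- cotangent of the angle at k in the triangle [i,j,k]
    cotAngle : ∀ {i j k} → Face i j k → Carrier
    cotAngle f = OppositeAngle.cotα (faceTriangle f)

    weight : Fin N → Fin N → Carrier
    weight i j with incidence i j
    ... | nonEdge _        = 0#
    ... | boundary f _     = ½ * cotAngle f
    ... | interior f g _ _ = ½ * (cotAngle f + cotAngle g)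

    laplacian : Fin N → Fin N → Carrier
    laplacian i j with i ≟ j
    ... | yes _ = sum (λ k → weight i k)
    ... | no  _ = - weight i j

{-# OPTIONS --safe #-}

-- For a triangle with sides a, b, c, opposite cotangents x, y, z and four
-- times its area h, one has h (y + z) = 2 a² and x y + y z + z x = 1.  For a
-- second triangle a′, b′, c′ these give the Neuberg–Pedoe inequality
--
--   (x - x′) a′² + (y - y′) b′² + (z - z′) c′² ≥ 0,
--
-- with equality only if the cotangents agree.  The sum of the left hand sides
-- over all faces is Σ (w₁ - w₂) d₂² over all edges, up to a factor.  If the
-- Laplacians agree it vanishes, so corresponding faces are similar; the ratio
-- of similarity is constant on faces, hence around each vertex because links
-- are connected, hence everywhere.

module Submission where

open import Defs
import Algebra.Properties.Semiring.Sum as SemiringSum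
open import Algebra.Bundles using (CommutativeRing)
open import Data.Empty using (⊥-elim)
open import Data.Fin.Base using (Fin; zero; suc; fromℕ<)
open import Data.Fin.Properties using (_≟_)
open import Data.List.Base using (List; []; _∷_)
open import Data.List.Membership.Propositional using (_∈_)
open import Data.List.Relation.Unary.All as All using (All; []; _∷_)
open import Data.List.Relation.Unary.Any using (here; there)
open import Data.Nat.Base using (ℕ; zero; suc; s≤s; >-nonZero⁻¹)
open import Data.Product.Base using (∃; ∃₂; _×_; _,_; proj₁; proj₂)
open import Data.Sum.Base using (_⊎_; inj₁; inj₂; [_,_]′)
open import Function.Base using (_∘_)
open import Function.Bundles using (_⇔_; mk⇔; Equivalence)
open import Level using (_⊔_)
open import Relation.Binary.Construct.Closure.ReflexiveTransitive using (Star; ε; _◅_)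
open import Relation.Binary.Core using (Rel)
open import Relation.Binary.PropositionalEquality.Core as ≡ using (_≡_; _≢_)
open import Relation.Nullary using (¬_; Dec; yes; no)
import Relation.Binary.Reasoning.Setoid as SetoidReasoning

-- Connectedness of vertex links.

module _ {a} {A : Set a} where

  Consecutive⇒∈ : ∀ {xs : List A} {x y} → Consecutive xs x y → x ∈ xs × y ∈ xs
  Consecutive⇒∈ here      = here ≡.refl , there (here ≡.refl)
  Consecutive⇒∈ (there c) = let x∈ , y∈ = Consecutive⇒∈ c in there x∈ , there y∈

  Neighbours⇒∈ : ∀ {xs : List A} {x y} → Neighbours xs x y → x ∈ xs
  Neighbours⇒∈ (inj₁ c) = proj₁ (Consecutive⇒∈ c)
  Neighbours⇒∈ (inj₂ c) = proj₂ (Consecutive⇒∈ c)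

module _ {a p} {A : Set a} {P : A → Set p} where

  spread-from-head : ∀ {x xs} → (∀ {y z} → Consecutive (x ∷ xs) y z → P y → P z) →
                     P x → All P (x ∷ xs)
  spread-from-head {xs = []}    step px = px ∷ []
  spread-from-head {xs = _ ∷ _} step px = px ∷ spread-from-head (step ∘ there) (step here px)

  -- Walks backwards along the list. Together with `spread-from-head` it joins any two members of a
  -- list through its head.
  reach-head : ∀ {x xs y} → (∀ {y z} → Consecutive (x ∷ xs) y z → P z → P y) →
               y ∈ x ∷ xs → P y → P x
  reach-head                step (here ≡.refl) py = py
  reach-head {xs = _ ∷ _}   step (there y∈)    py = step here (reach-head (step ∘ there) y∈ py)

  neighbours-connected : ∀ {xs x y} → (∀ {u v} → Neighbours xs u v → P u → P v) →
                         x ∈ xs → y ∈ xs → P x → P y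
  neighbours-connected {_ ∷ _} step x∈ y∈ px =
    All.lookup (spread-from-head (step ∘ inj₁) (reach-head (step ∘ inj₂) x∈ px)) y∈

  -- Arcs and circles are described up to isolated points. The neighbours `x′` and `y′` show that
  -- `x` and `y` are not isolated, hence lie on the list of the arc or circle.
  link-connected : ∀ {G : Rel A _} → IsCircle G ⊎ IsArc G →
                   (∀ {u v} → G u v → P u → P v) →
                   ∀ {x x′ y y′} → G x x′ → G y y′ → P x → P y
  link-connected {G} l step {x} {x′} {y} {y′} gx gy = go l
    where
    via : ∀ xs → (∀ u v → G u v ⇔ Neighbours xs u v) → P x → P y
    via xs iso = neighbours-connected (λ {u} {v} n → step (Equivalence.from (iso u v) n))
      (Neighbours⇒∈ (Equivalence.to (iso x x′) gx))
      (Neighbours⇒∈ (Equivalence.to (iso y y′) gy))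
    go : IsCircle G ⊎ IsArc G → P x → P y
    go (inj₁ (_ , _ , _ , _ , iso)) = via _ iso
    go (inj₂ (_ , _ , _ , iso))     = via _ iso

link-nonempty : ∀ {a} {A : Set a} {G : Rel A _} → IsCircle G ⊎ IsArc G → ∃₂ G
link-nonempty (inj₁ (x , y ∷ _ , _ , _ , iso)) = x , y , Equivalence.from (iso x y) (inj₁ here)
link-nonempty (inj₁ (x , [] , s≤s () , _))
link-nonempty (inj₂ (x ∷ y ∷ _ , _ , _ , iso)) = x , y , Equivalence.from (iso x y) (inj₁ here)
link-nonempty (inj₂ ([] , () , _))
link-nonempty (inj₂ (_ ∷ [] , s≤s () , _))

-- `Incidence P` lists every element of `P`, so comparison with the list decides membership. This
-- permits a case distinction on whether a triple of vertices is a face.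
incidence⇒dec : ∀ {N} {P : Fin N → Set} → Incidence P → ∀ m → Dec (P m)
incidence⇒dec (nonEdge ¬p) m = no λ p → ¬p (m , p)
incidence⇒dec (boundary {k} p unique) m with m ≟ k
... | yes ≡.refl = yes p
... | no  m≢k    = no λ q → m≢k (unique m q)
incidence⇒dec (interior {k} {l} p q _ unique) m with m ≟ k | m ≟ l
... | yes ≡.refl | _          = yes p
... | no _       | yes ≡.refl = yes q
... | no m≢k     | no m≢l     = no λ r → [ m≢k , m≢l ]′ (unique m r)

-- Nonnegativity, squares and finite sums in a constructively ordered field.

module OrderedFieldLemmas {c ℓ₁ ℓ₂ ℓ₃} (ℝ : RealNumbers c ℓ₁ ℓ₂ ℓ₃) where

  open RealNumbers ℝ hiding (zero)
  open RealProperties ℝ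
  open SemiringSum (CommutativeRing.semiring commutativeRing) using
    (sum-cong-≋; ∑-comm; ∑-distrib-+; sum-replicate-zero)

  -- The order is not assumed decidable, so the relation 0 ≤ x is a negation instead of a
  -- disjunction of 0 < x and x ≈ 0.
  NonNegative : Carrier → Set ℓ₃
  NonNegative x = ¬ x < 0#

  nonNeg-resp : ∀ {x y} → x ≈ y → NonNegative x → NonNegative y
  nonNeg-resp x≈y 0≤x y<0 = 0≤x (<-respˡ-≈ (sym x≈y) y<0)

  ≈0⇒nonNeg : ∀ {x} → x ≈ 0# → NonNegative x
  ≈0⇒nonNeg x≈0 = <-irrefl x≈0

  -- Cotransitivity places `x` relative to `x + y < 0#`: either `x + y < x`, which makes `y`
  -- negative, or `x < 0#`.
  +-nonNeg : ∀ {x y} → NonNegative x → NonNegative y → NonNegative (x + y)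
  +-nonNeg {x} {y} 0≤x 0≤y x+y<0 = [ (λ x+y<x → 0≤y (pos⇒< eq (x<y⇒0<y-x x+y<x))) , 0≤x ]′
    (<-cotrans x+y<0 x)
    where
    eq : x - (x + y) ≈ 0# - y
    eq = trans (solve 2 (λ x y → x :- (x :+ y) := (x :- x) :- y) refl x y) (+-congʳ (-‿inverseʳ x))

  +-nonNeg-≈0ˡ : ∀ {x y} → NonNegative x → NonNegative y → x + y ≈ 0# → x ≈ 0#
  +-nonNeg-≈0ˡ {x} {y} 0≤x 0≤y x+y≈0 = ≮∧≯⇒≈ 0≤x λ 0<x → 0≤y
    (<-respʳ-≈ x+y≈0 (<-respˡ-≈ (+-identityˡ y) (+-monoˡ-< y 0<x)))

  +-nonNeg-≈0ʳ : ∀ {x y} → NonNegative x → NonNegative y → x + y ≈ 0# → y ≈ 0#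
  +-nonNeg-≈0ʳ 0≤x 0≤y x+y≈0 = +-nonNeg-≈0ˡ 0≤y 0≤x (trans (+-comm _ _) x+y≈0)

  neg-square : ∀ x → (0# - x) * (0# - x) ≈ x * x
  neg-square x = trans (*-cong (+-identityˡ (- x)) (+-identityˡ (- x)))
    (solve 1 (λ x → (:- x) :* (:- x) := x :* x) refl x)

  -- By tightness of the apartness it suffices to refute `x < 0#` and `0# < x`, and each of them
  -- would make the square positive.
  square-nonPos⇒≈0 : ∀ {x} → ¬ 0# < x * x → x ≈ 0#
  square-nonPos⇒≈0 {x} 0≮x² = ≮∧≯⇒≈
    (λ x<0 → 0≮x² (<-respʳ-≈ (neg-square x) (*-pos (x<y⇒0<y-x x<0) (x<y⇒0<y-x x<0))))
    (λ 0<x → 0≮x² (*-pos 0<x 0<x))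

  square-≈0⇒≈0 : ∀ {x} → x * x ≈ 0# → x ≈ 0#
  square-≈0⇒≈0 x²≈0 = square-nonPos⇒≈0 (<-irrefl (sym x²≈0))

  -- A negative square is in particular not positive, so `x` vanishes, and then so does its square.
  square-nonNeg : ∀ x → NonNegative (x * x)
  square-nonNeg x x²<0 = <-irrefl
    (trans (*-congʳ (square-nonPos⇒≈0 (<-asym x²<0))) (zeroˡ x)) x²<0

  recip-*-* : ∀ {x} (0<x : 0# < x) y → recip 0<x * (x * y) ≈ y
  recip-*-* {x} 0<x y = trans (sym (*-assoc (recip 0<x) x y))
    (trans (*-congʳ (recip-inverseˡ 0<x)) (*-identityˡ y))

  *-nonNeg : ∀ {x y} → 0# < x → NonNegative y → NonNegative (x * y)
  *-nonNeg {y = y} 0<x 0≤y xy<0 = 0≤y (<-respˡ-≈ (recip-*-* 0<x y) (<-respʳ-≈ (zeroʳ (recip 0<x))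
    (*-monoˡ-< (recip-pos 0<x) xy<0)))

  *-cancel-nonNeg : ∀ {x y} → 0# < x → NonNegative (x * y) → NonNegative y
  *-cancel-nonNeg {x} 0<x 0≤xy y<0 = 0≤xy (<-respʳ-≈ (zeroʳ x) (*-monoˡ-< 0<x y<0))

  *-cancel-pos : ∀ {x y} → 0# < x → 0# < x * y → 0# < y
  *-cancel-pos {y = y} 0<x 0<xy = <-respʳ-≈ (recip-*-* 0<x y) (*-pos (recip-pos 0<x) 0<xy)

  *-cancelˡ : ∀ {x y z} → 0# < x → x * y ≈ x * z → y ≈ z
  *-cancelˡ {x} {y} {z} 0<x xy≈xz = ≮∧≯⇒≈
    (λ y<z → <-irrefl xy≈xz (*-monoˡ-< 0<x y<z))
    (λ z<y → <-irrefl (sym xy≈xz) (*-monoˡ-< 0<x z<y))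

  *-cancelˡ-≈0 : ∀ {x y} → 0# < x → x * y ≈ 0# → y ≈ 0#
  *-cancelˡ-≈0 {x} 0<x xy≈0 = *-cancelˡ 0<x (trans xy≈0 (sym (zeroʳ x)))

  x-y≈0⇒x≈y : ∀ {x y} → x - y ≈ 0# → x ≈ y
  x-y≈0⇒x≈y {x} {y} x-y≈0 = trans (solve 2 (λ x y → x := (x :- y) :+ y) refl x y)
    (trans (+-congʳ x-y≈0) (+-identityˡ y))

  neg-injective : ∀ {x y} → - x ≈ - y → x ≈ y
  neg-injective {x} {y} -x≈-y = trans (solve 1 (λ x → x := :- (:- x)) refl x)
    (trans (-‿cong -x≈-y) (solve 1 (λ y → :- (:- y) := y) refl y))

  x≈y⇒x-y≈0 : ∀ {x y} → x ≈ y → x - y ≈ 0#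
  x≈y⇒x-y≈0 {x} {y} x≈y = trans (+-congʳ x≈y) (-‿inverseʳ y)

  square-injective : ∀ {x y} → 0# < x → 0# < y → x * x ≈ y * y → x ≈ y
  square-injective {x} {y} 0<x 0<y x²≈y² = x-y≈0⇒x≈y (*-cancelˡ-≈0 (+-pos 0<x 0<y)
    (trans (solve 2 (λ x y → (x :+ y) :* (x :- y) := x :* x :- y :* y) refl x y)
           (x≈y⇒x-y≈0 x²≈y²)))

  *-recip-* : ∀ {y} x (0<y : 0# < y) → x * recip 0<y * y ≈ x
  *-recip-* {y} x 0<y = trans (*-assoc x (recip 0<y) y)
    (trans (*-congˡ (recip-inverseˡ 0<y)) (*-identityʳ x))

  sum-nonNeg : ∀ {n} (f : Fin n → Carrier) → (∀ i → NonNegative (f i)) → NonNegative (sum f)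
  sum-nonNeg {zero}  f 0≤f = <-irrefl refl
  sum-nonNeg {suc n} f 0≤f = +-nonNeg (0≤f zero) (sum-nonNeg (f ∘ suc) (0≤f ∘ suc))

  sum-nonNeg-≈0 : ∀ {n} (f : Fin n → Carrier) → (∀ i → NonNegative (f i)) →
                  sum f ≈ 0# → ∀ i → f i ≈ 0#
  sum-nonNeg-≈0 f 0≤f ∑f≈0 zero    = +-nonNeg-≈0ˡ (0≤f zero) (sum-nonNeg (f ∘ suc) (0≤f ∘ suc)) ∑f≈0
  sum-nonNeg-≈0 f 0≤f ∑f≈0 (suc i) = sum-nonNeg-≈0 (f ∘ suc) (0≤f ∘ suc)
    (+-nonNeg-≈0ʳ (0≤f zero) (sum-nonNeg (f ∘ suc) (0≤f ∘ suc)) ∑f≈0) i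

  sum-≈0 : ∀ {n} (f : Fin n → Carrier) → (∀ i → f i ≈ 0#) → sum f ≈ 0#
  sum-≈0 {n} f f≈0 = trans (sum-cong-≋ f≈0) (sum-replicate-zero n)

  sum₃ : ∀ {n} → (Fin n → Fin n → Fin n → Carrier) → Carrier
  sum₃ F = sum λ i → sum λ j → sum λ k → F i j k

  sum₃-distrib-+ : ∀ {n} (F G : Fin n → Fin n → Fin n → Carrier) →
                   sum₃ (λ i j k → F i j k + G i j k) ≈ sum₃ F + sum₃ G
  sum₃-distrib-+ F G = trans
    (sum-cong-≋ λ i → trans (sum-cong-≋ λ j → ∑-distrib-+ (F i j) (G i j))
      (∑-distrib-+ (λ j → sum (F i j)) (λ j → sum (G i j))))
    (∑-distrib-+ (λ i → sum λ j → sum (F i j)) (λ i → sum λ j → sum (G i j)))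

  -- A cyclic shift of the indices is the product of two transpositions, each an exchange of
  -- adjacent sums.
  sum₃-rotate : ∀ {n} (F : Fin n → Fin n → Fin n → Carrier) →
                sum₃ (λ i j k → F j k i) ≈ sum₃ F
  sum₃-rotate F = trans (∑-comm (λ i j → sum λ k → F j k i)) (sum-cong-≋ λ j → ∑-comm (λ i k → F j k i))

  sum₃-nonNeg-≈0 : ∀ {n} (F : Fin n → Fin n → Fin n → Carrier) → (∀ i j k → NonNegative (F i j k)) →
                   sum₃ F ≈ 0# → ∀ i j k → F i j k ≈ 0#
  sum₃-nonNeg-≈0 F 0≤F ∑F≈0 i j = sum-nonNeg-≈0 (F i j) (0≤F i j)
    (sum-nonNeg-≈0 (λ j → sum (F i j)) (0≤∑F i)
      (sum-nonNeg-≈0 (λ i → sum λ j → sum (F i j)) (λ i → sum-nonNeg (λ j → sum (F i j)) (0≤∑F i)) ∑F≈0 i) j)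
    where
    0≤∑F : ∀ i j → NonNegative (sum (F i j))
    0≤∑F i j = sum-nonNeg (F i j) (0≤F i j)

  single : ∀ {n} → Fin n → Carrier → Fin n → Carrier
  single zero    x zero    = x
  single zero    x (suc m) = 0#
  single (suc k) x zero    = 0#
  single (suc k) x (suc m) = single k x m

  single-≡ : ∀ {n} (k : Fin n) x → single k x k ≈ x
  single-≡ zero    x = refl
  single-≡ (suc k) x = single-≡ k x

  single-≢ : ∀ {n} {k m : Fin n} x → m ≢ k → single k x m ≈ 0#
  single-≢ {k = zero}  {zero}  x m≢k = ⊥-elim (m≢k ≡.refl)
  single-≢ {k = zero}  {suc m} x m≢k = refl
  single-≢ {k = suc k} {zero}  x m≢k = refl
  single-≢ {k = suc k} {suc m} x m≢k = single-≢ x (m≢k ∘ ≡.cong suc)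

  sum-single : ∀ {n} (k : Fin n) x → sum (single k x) ≈ x
  sum-single {suc n} zero x = trans (+-congˡ (sum-≈0 {n} (λ _ → 0#) λ _ → refl)) (+-identityʳ x)
  sum-single (suc k) x = trans (+-identityˡ (sum (single k x))) (sum-single k x)

  -- Sums over the triangles at an edge.

  module _ {n} {P : Fin n → Set} where

    total : Incidence P → (∀ {m} → P m → Carrier) → Carrier
    total (nonEdge _)        v = 0#
    total (boundary p _)     v = v p
    total (interior p q _ _) v = v p + v q

    -- Extension of `v` by zero outside `P`. It turns the sum over the at most two triangles at an
    -- edge into a sum over all vertices, where the order of summation can be changed.
    spread : Incidence P → (∀ {m} → P m → Carrier) → Fin n → Carrier
    spread (nonEdge _)                v m = 0#
    spread (boundary {k} p _)         v m = single k (v p) m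
    spread (interior {k} {l} p q _ _) v m = single k (v p) m + single l (v q) m

    sum-spread : ∀ I (v : ∀ {m} → P m → Carrier) → sum (spread I v) ≈ total I v
    sum-spread (nonEdge _)                v = sum-≈0 {n} (λ _ → 0#) λ _ → refl
    sum-spread (boundary {k} p _)         v = sum-single k (v p)
    sum-spread (interior {k} {l} p q _ _) v = trans (∑-distrib-+ (single k (v p)) (single l (v q)))
      (+-cong (sum-single k (v p)) (sum-single l (v q)))

    -- The incidence stores one particular proof of `P m`; irrelevance of `v` exchanges it for `p`.
    spread-∈ : ∀ I (v : ∀ {m} → P m → Carrier) → (∀ {m} (p q : P m) → v p ≈ v q) → ∀ {m} (p : P m) → spread I v m ≈ v p
    spread-∈ (nonEdge ¬p) v irr p = ⊥-elim (¬p (_ , p))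
    spread-∈ (boundary {k} q unique) v irr p with unique _ p
    ... | ≡.refl = trans (single-≡ k (v q)) (irr q p)
    spread-∈ (interior {k} {l} q r k≢l unique) v irr p with unique _ p
    ... | inj₁ ≡.refl = trans (+-cong (single-≡ k (v q)) (single-≢ (v r) k≢l))
                              (trans (+-identityʳ (v q)) (irr q p))
    ... | inj₂ ≡.refl = trans (+-cong (single-≢ (v q) (k≢l ∘ ≡.sym)) (single-≡ l (v r)))
                              (trans (+-identityˡ (v r)) (irr r p))

    spread-∉ : ∀ I (v : ∀ {m} → P m → Carrier) {m} → ¬ P m → spread I v m ≈ 0#
    spread-∉ (nonEdge _) v ¬p = refl
    spread-∉ (boundary {k} q _) v ¬p = single-≢ {k = k} (v q) λ { ≡.refl → ¬p q }
    spread-∉ (interior {k} {l} q r _ _) v ¬p = trans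
      (+-cong (single-≢ {k = k} (v q) λ { ≡.refl → ¬p q })
              (single-≢ {k = l} (v r) λ { ≡.refl → ¬p r }))
      (+-identityˡ 0#)

    total-minus : ∀ I (v w : ∀ {m} → P m → Carrier) →
                  total I (λ p → v p - w p) ≈ total I v - total I w
    total-minus (nonEdge _)        v w = sym (-‿inverseʳ 0#)
    total-minus (boundary p _)     v w = refl
    total-minus (interior p q _ _) v w =
      solve 4 (λ a b c d → (a :- b) :+ (c :- d) := (a :+ c) :- (b :+ d)) refl (v p) (w p) (v q) (w q)

    total-cong : ∀ I {v w : ∀ {m} → P m → Carrier} → (∀ {m} (p : P m) → v p ≈ w p) →
                 total I v ≈ total I w
    total-cong (nonEdge _)        v≈w = refl
    total-cong (boundary p _)     v≈w = v≈w p
    total-cong (interior p q _ _) v≈w = +-cong (v≈w p) (v≈w q)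

-- Cotangents and areas of Euclidean triangles.

module TriangleLemmas {k ℓ₁ ℓ₂ ℓ₃} (ℝ : RealNumbers k ℓ₁ ℓ₂ ℓ₃) where

  open RealNumbers ℝ
  open RealProperties ℝ
  open EuclideanTriangles ℝ
  open OrderedFieldLemmas ℝ
  open OppositeAngle using (cotα)
  open SetoidReasoning setoid

  -- Sixteen times the squared area, by Heron's formula.
  heron : Carrier → Carrier → Carrier → Carrier
  heron a b c = (a + b + c) * (b + c - a) * (c + a - b) * (a + b - c)

  heron-pos : ∀ {a b c} → Triangle a b c → 0# < heron a b c
  heron-pos t = *-pos (*-pos (*-pos (+-pos (+-pos 0<a 0<b) 0<c)
    (x<y⇒0<y-x a<b+c)) (x<y⇒0<y-x b<c+a)) (x<y⇒0<y-x c<a+b)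
    where open Triangle t

  heron-rotate : ∀ a b c → heron a b c ≈ heron b c a
  heron-rotate = solve 3 (λ a b c →
    (a :+ b :+ c) :* (b :+ c :- a) :* (c :+ a :- b) :* (a :+ b :- c) :=
    (b :+ c :+ a) :* (c :+ a :- b) :* (a :+ b :- c) :* (b :+ c :- a)) refl

  double : ∀ x → 2# * x ≈ x + x
  double x = trans (distribʳ x 1# 1#) (+-cong (*-identityˡ x) (*-identityˡ x))

  cot-law : ∀ {a b c h} (t : Triangle a b c) → 0# < h → h * h ≈ heron a b c →
            cotα t * h ≈ b * b + c * c - a * a
  cot-law {a} {b} {c} {h} t 0<h h² = begin
    cotα t * h           ≈⟨ *-congˡ (sym sin*m≈h) ⟩
    cotα t * (sinα * m)  ≈⟨ sym (*-assoc (cotα t) sinα m) ⟩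
    cotα t * sinα * m    ≈⟨ *-congʳ (*-recip-* cosα 0<sin) ⟩
    cosα * m             ≈⟨ cos*m ⟩
    p                    ∎
    where
    open Triangle t
    open OppositeAngle t using (cosα; sinα; 0<1-cos²α)
    m p : Carrier
    m = 2# * (b * c)
    p = b * b + c * c - a * a
    0<m : 0# < m
    0<m = *-pos 0<2 (*-pos 0<b 0<c)
    0<sin : 0# < sinα
    0<sin = sqrt-pos 0<1-cos²α
    cos*m : cosα * m ≈ p
    cos*m = *-recip-* p 0<m
    sin*m≈h : sinα * m ≈ h
    sin*m≈h = square-injective (*-pos 0<sin 0<m) 0<h (begin
      sinα * m * (sinα * m)
        ≈⟨ solve 2 (λ s m → s :* m :* (s :* m) := s :* s :* (m :* m)) refl sinα m ⟩
      sinα * sinα * (m * m)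
        ≈⟨ *-congʳ (sqrt² 0<1-cos²α) ⟩
      (1# - cosα * cosα) * (m * m)
        ≈⟨ solve 3 (λ o k m → (o :- k :* k) :* (m :* m) := o :* (m :* m) :- (k :* m) :* (k :* m))
             refl 1# cosα m ⟩
      1# * (m * m) - (cosα * m) * (cosα * m)
        ≈⟨ +-cong (trans (*-identityˡ (m * m)) (*-cong (double (b * c)) (double (b * c))))
             (-‿cong (*-cong cos*m cos*m)) ⟩
      (b * c + b * c) * (b * c + b * c) - p * p
        ≈⟨ solve 3 (λ a b c →
             (b :* c :+ b :* c) :* (b :* c :+ b :* c) :-
               (b :* b :+ c :* c :- a :* a) :* (b :* b :+ c :* c :- a :* a) :=
             (a :+ b :+ c) :* (b :+ c :- a) :* (c :+ a :- b) :* (a :+ b :- c)) refl a b c ⟩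
      heron a b c
        ≈⟨ sym h² ⟩
      h * h ∎)

  -- Areas scale by `s * s`. After multiplication by `s * s * h`, four times the area of the second
  -- triangle, both cotangents become the same expression in the sides.
  cot-scale : ∀ {a b c a′ b′ c′ s} (t : Triangle a b c) (t′ : Triangle a′ b′ c′) → 0# < s →
              a′ ≈ s * a → b′ ≈ s * b → c′ ≈ s * c → cotα t ≈ cotα t′
  cot-scale {a} {b} {c} {a′} {b′} {c′} {s} t t′ 0<s a′≈ b′≈ c′≈ = *-cancelˡ 0<h′ (begin
    s * s * h * cotα t
      ≈⟨ solve 3 (λ s h x → s :* s :* h :* x := s :* s :* (x :* h)) refl s h (cotα t) ⟩
    s * s * (cotα t * h)
      ≈⟨ *-congˡ (cot-law t 0<h (sqrt² 0<heron)) ⟩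
    s * s * (b * b + c * c - a * a)
      ≈⟨ solve 4 (λ a b c s → s :* s :* (b :* b :+ c :* c :- a :* a) :=
           s :* b :* (s :* b) :+ s :* c :* (s :* c) :- s :* a :* (s :* a)) refl a b c s ⟩
    s * b * (s * b) + s * c * (s * c) - s * a * (s * a)
      ≈⟨ sym (+-cong (+-cong (*-cong b′≈ b′≈) (*-cong c′≈ c′≈)) (-‿cong (*-cong a′≈ a′≈))) ⟩
    b′ * b′ + c′ * c′ - a′ * a′
      ≈⟨ sym (cot-law t′ 0<h′ h′²) ⟩
    cotα t′ * (s * s * h)
      ≈⟨ *-comm (cotα t′) _ ⟩
    s * s * h * cotα t′ ∎)
    where
    0<heron = heron-pos t
    h = sqrt 0<heron
    0<h = sqrt-pos 0<heron
    0<h′ = *-pos (*-pos 0<s 0<s) 0<h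
    h′² : s * s * h * (s * s * h) ≈ heron a′ b′ c′
    h′² = begin
      s * s * h * (s * s * h)
        ≈⟨ solve 2 (λ s h → s :* s :* h :* (s :* s :* h) := s :* s :* (s :* s) :* (h :* h)) refl s h ⟩
      s * s * (s * s) * (h * h)
        ≈⟨ *-congˡ (sqrt² 0<heron) ⟩
      s * s * (s * s) * heron a b c
        ≈⟨ solve 4 (λ a b c s → s :* s :* (s :* s) :*
               ((a :+ b :+ c) :* (b :+ c :- a) :* (c :+ a :- b) :* (a :+ b :- c)) :=
             (s :* a :+ s :* b :+ s :* c) :* (s :* b :+ s :* c :- s :* a) :*
               (s :* c :+ s :* a :- s :* b) :* (s :* a :+ s :* b :- s :* c)) refl a b c s ⟩
      heron (s * a) (s * b) (s * c)
        ≈⟨ sym (*-cong (*-cong (*-cong (+-cong (+-cong a′≈ b′≈) c′≈)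
             (+-cong (+-cong b′≈ c′≈) (-‿cong a′≈)))
             (+-cong (+-cong c′≈ a′≈) (-‿cong b′≈)))
             (+-cong (+-cong a′≈ b′≈) (-‿cong c′≈))) ⟩
      heron a′ b′ c′ ∎

  -- The inverses and the square root in `cotα` are built from the proofs in `t`; scaling by 1 shows
  -- that the value depends on the sides only.
  cot-irrelevant : ∀ {a b c} (t t′ : Triangle a b c) → cotα t ≈ cotα t′
  cot-irrelevant t t′ = cot-scale t t′ 0<1 (sym (*-identityˡ _)) (sym (*-identityˡ _)) (sym (*-identityˡ _))

  -- The symmetric bilinear form whose value at a pair of equal vectors is twice `quadratic`.
  pairing : (x y z x′ y′ z′ : Carrier) → Carrier
  pairing x y z x′ y′ z′ = x * (y′ + z′) + y * (z′ + x′) + z * (x′ + y′)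

  quadratic : (x y z : Carrier) → Carrier
  quadratic x y z = x * y + y * z + z * x

  -- h is four times the area of the triangle with sides a, b, c, and x, y, z
  -- are the cotangents of the angles opposite to them.
  record Cotangents (a b c x y z : Carrier) : Set (k ⊔ ℓ₁ ⊔ ℓ₃) where
    field
      0<a  : 0# < a
      0<b  : 0# < b
      0<c  : 0# < c
      h    : Carrier
      0<h  : 0# < h
      h²   : h * h ≈ heron a b c
      xh   : x * h ≈ b * b + c * c - a * a
      yh   : y * h ≈ c * c + a * a - b * b
      zh   : z * h ≈ a * a + b * b - c * c

    [y+z]h : h * (y + z) ≈ a * a + a * a
    [y+z]h = trans (solve 3 (λ h y z → h :* (y :+ z) := y :* h :+ z :* h) refl h y z)
      (trans (+-cong yh zh)
        (solve 3 (λ a b c → (c :+ a :- b) :+ (a :+ b :- c) := a :+ a) refl (a * a) (b * b) (c * c)))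

    -- A single cotangent may be negative, but a sum of two is 2a² / h.
    0<y+z : 0# < y + z
    0<y+z = *-cancel-pos 0<h (<-respʳ-≈ (sym [y+z]h) (+-pos (*-pos 0<a 0<a) (*-pos 0<a 0<a)))

    -- Multiplied by `h * h`, the left side becomes a polynomial in the sides, which is Heron's
    -- product.
    quadratic≈1 : quadratic x y z ≈ 1#
    quadratic≈1 = *-cancelˡ (*-pos 0<h 0<h) (begin
      h * h * quadratic x y z
        ≈⟨ solve 4 (λ h x y z → h :* h :* (x :* y :+ y :* z :+ z :* x) :=
             x :* h :* (y :* h) :+ y :* h :* (z :* h) :+ z :* h :* (x :* h)) refl h x y z ⟩
      x * h * (y * h) + y * h * (z * h) + z * h * (x * h)
        ≈⟨ +-cong (+-cong (*-cong xh yh) (*-cong yh zh)) (*-cong zh xh) ⟩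
      _ ≈⟨ solve 3 (λ a b c → let p = b :* b :+ c :* c :- a :* a
                                  q = c :* c :+ a :* a :- b :* b
                                  r = a :* a :+ b :* b :- c :* c in
             p :* q :+ q :* r :+ r :* p :=
             (a :+ b :+ c) :* (b :+ c :- a) :* (c :+ a :- b) :* (a :+ b :- c)) refl a b c ⟩
      heron a b c ≈⟨ sym h² ⟩
      h * h       ≈⟨ sym (*-identityʳ (h * h)) ⟩
      h * h * 1#  ∎)

  rotate-cotangents : ∀ {a b c x y z} → Cotangents a b c x y z → Cotangents b c a y z x
  rotate-cotangents {a} {b} {c} C = record
    { 0<a = 0<b ; 0<b = 0<c ; 0<c = 0<a ; h = h ; 0<h = 0<h
    ; h² = trans h² (heron-rotate a b c) ; xh = yh ; yh = zh ; zh = xh }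
    where open Cotangents C

  cotangents : ∀ {a b c} (t₁ : Triangle a b c) (t₂ : Triangle b c a) (t₃ : Triangle c a b) →
               Cotangents a b c (cotα t₁) (cotα t₂) (cotα t₃)
  cotangents {a} {b} {c} t₁ t₂ t₃ = record
    { 0<a = 0<a ; 0<b = 0<b ; 0<c = 0<c ; h = sqrt 0<heron ; 0<h = 0<h
    ; h² = sqrt² 0<heron
    ; xh = cot-law t₁ 0<h (sqrt² 0<heron)
    ; yh = cot-law t₂ 0<h (trans (sqrt² 0<heron) (heron-rotate a b c))
    ; zh = cot-law t₃ 0<h (trans (sqrt² 0<heron)
             (trans (heron-rotate a b c) (heron-rotate b c a)))
    }
    where
    open Triangle t₁
    0<heron = heron-pos t₁
    0<h = sqrt-pos 0<heron

  -- The Neuberg-Pedoe inequality and its equality case.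

  module Comparison {a b c x y z a′ b′ c′ x′ y′ z′}
    (C : Cotangents a b c x y z) (C′ : Cotangents a′ b′ c′ x′ y′ z′) where

    private
      module C  = Cotangents C
      module C′ = Cotangents C′
      h′ = C′.h
      s s′ u v : Carrier
      s  = y + z
      s′ = y′ + z′
      u  = s′ - s
      v  = y * s′ - y′ * s

    defect : Carrier
    defect = (x - x′) * (a′ * a′) + (y - y′) * (b′ * b′) + (z - z′) * (c′ * c′)

    -- The form of signature (1,2) polarising `quadratic` satisfies a reverse
    -- Cauchy–Schwarz inequality on vectors with `quadratic` equal to 1.
    pairing-excess : s * s′ * (pairing x y z x′ y′ z′ - (1# + 1#)) ≈ u * u + v * v
    pairing-excess = begin
      s * s′ * (pairing x y z x′ y′ z′ - (1# + 1#))
        ≈⟨ *-congˡ (+-congˡ (-‿cong (sym (+-cong C.quadratic≈1 C′.quadratic≈1)))) ⟩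
      s * s′ * (pairing x y z x′ y′ z′ - (quadratic x y z + quadratic x′ y′ z′))
        -- The identity comes from eliminating x = (q - y z) / s and x′ = (q′ - y′ z′) / s′. What
        -- remains besides the terms in q and q′ is (y s′ - y′ s)(z′ s - z s′), and both factors
        -- equal v.
        ≈⟨ solve 6 (λ x y z x′ y′ z′ →
             let s = y :+ z
                 s′ = y′ :+ z′
                 q = x :* y :+ y :* z :+ z :* x
                 q′ = x′ :* y′ :+ y′ :* z′ :+ z′ :* x′
                 v = y :* s′ :- y′ :* s in
             s :* s′ :* ((x :* (y′ :+ z′) :+ y :* (z′ :+ x′) :+ z :* (x′ :+ y′)) :- (q :+ q′)) :=
             (q :* s′ :- q′ :* s) :* (s′ :- s) :+ v :* v) refl x y z x′ y′ z′ ⟩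
      (quadratic x y z * s′ - quadratic x′ y′ z′ * s) * u + v * v
        ≈⟨ +-congʳ (*-congʳ (+-cong
             (trans (*-congʳ C.quadratic≈1) (*-identityˡ s′))
             (-‿cong (trans (*-congʳ C′.quadratic≈1) (*-identityˡ s))))) ⟩
      u * u + v * v ∎

    -- The relation h′ (y′ + z′) = 2 a′² and its rotations replace squared sides by cotangents. The
    -- primed vector paired with itself contributes the constant 2.
    defect-excess : defect + defect ≈ h′ * (pairing x y z x′ y′ z′ - (1# + 1#))
    defect-excess = begin
      defect + defect
        ≈⟨ solve 6 (λ p q r a b c →
             (p :* a :+ q :* b :+ r :* c) :+ (p :* a :+ q :* b :+ r :* c) :=
             p :* (a :+ a) :+ q :* (b :+ b) :+ r :* (c :+ c)) refl
             (x - x′) (y - y′) (z - z′) (a′ * a′) (b′ * b′) (c′ * c′) ⟩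
      (x - x′) * (a′ * a′ + a′ * a′) + (y - y′) * (b′ * b′ + b′ * b′) + (z - z′) * (c′ * c′ + c′ * c′)
        ≈⟨ sym (+-cong (+-cong (*-congˡ C′.[y+z]h)
             (*-congˡ (Cotangents.[y+z]h C″)))
             (*-congˡ (Cotangents.[y+z]h (rotate-cotangents C″)))) ⟩
      (x - x′) * (h′ * (y′ + z′)) + (y - y′) * (h′ * (z′ + x′)) + (z - z′) * (h′ * (x′ + y′))
        ≈⟨ solve 7 (λ h x y z x′ y′ z′ →
             let q′ = x′ :* y′ :+ y′ :* z′ :+ z′ :* x′ in
             (x :- x′) :* (h :* (y′ :+ z′)) :+ (y :- y′) :* (h :* (z′ :+ x′)) :+
               (z :- z′) :* (h :* (x′ :+ y′)) :=
             h :* ((x :* (y′ :+ z′) :+ y :* (z′ :+ x′) :+ z :* (x′ :+ y′)) :- (q′ :+ q′)))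
             refl h′ x y z x′ y′ z′ ⟩
      h′ * (pairing x y z x′ y′ z′ - (quadratic x′ y′ z′ + quadratic x′ y′ z′))
        ≈⟨ *-congˡ (+-congˡ (-‿cong (+-cong C′.quadratic≈1 C′.quadratic≈1))) ⟩
      h′ * (pairing x y z x′ y′ z′ - (1# + 1#)) ∎
      where C″ = rotate-cotangents C′

    private
      0<ss′ : 0# < s * s′
      0<ss′ = *-pos C.0<y+z C′.0<y+z

      ss′defect : s * s′ * (2# * defect) ≈ h′ * (u * u + v * v)
      ss′defect = begin
        s * s′ * (2# * defect)       ≈⟨ *-congˡ (trans (double defect) defect-excess) ⟩
        s * s′ * (h′ * e)
          ≈⟨ solve 3 (λ m h e → m :* (h :* e) := h :* (m :* e)) refl (s * s′) h′ e ⟩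
        h′ * (s * s′ * e)            ≈⟨ *-congˡ pairing-excess ⟩
        h′ * (u * u + v * v)         ∎
        where e = pairing x y z x′ y′ z′ - (1# + 1#)

    defect-nonNeg : NonNegative defect
    defect-nonNeg = *-cancel-nonNeg 0<2 (*-cancel-nonNeg 0<ss′ (nonNeg-resp (sym ss′defect)
      (*-nonNeg C′.0<h (+-nonNeg (square-nonNeg u) (square-nonNeg v)))))

    -- Equality forces `u * u + v * v` to vanish, hence also `u`. The corresponding statements for
    -- the other two sums follow by rotating the triangles.
    defect≈0⇒y+z≈y′+z′ : defect ≈ 0# → y + z ≈ y′ + z′
    defect≈0⇒y+z≈y′+z′ defect≈0 = sym (x-y≈0⇒x≈y (square-≈0⇒≈0
      (+-nonNeg-≈0ˡ (square-nonNeg u) (square-nonNeg v)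
        (*-cancelˡ-≈0 C′.0<h (trans (sym ss′defect)
          (trans (*-congˡ (trans (*-congˡ defect≈0) (zeroʳ 2#))) (zeroʳ (s * s′))))))))

  defect-rotate : ∀ {a b c x y z a′ b′ c′ x′ y′ z′}
    (C : Cotangents a b c x y z) (C′ : Cotangents a′ b′ c′ x′ y′ z′) →
    Comparison.defect C C′ ≈ Comparison.defect (rotate-cotangents C) (rotate-cotangents C′)
  defect-rotate C C′ = trans (+-assoc _ _ _) (+-comm _ _)

  -- Since h (y + z) = 2 a², equal cotangents give a′² h = a² h′, and the same
  -- for b.
  similar : ∀ {a b c x y z a′ b′ c′ x′ y′ z′ r}
    (C : Cotangents a b c x y z) (C′ : Cotangents a′ b′ c′ x′ y′ z′) →
    Comparison.defect C C′ ≈ 0# → 0# < r → a′ ≈ r * a → b′ ≈ r * b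
  similar {a} {b} {c} {x} {y} {z} {a′} {b′} {c′} {x′} {y′} {z′} {r} C C′ defect≈0 0<r a′≈ra =
    square-injective C′.0<b (*-pos 0<r C.0<b) (*-cancelˡ C.0<h (begin
      C.h * (b′ * b′)           ≈⟨ proportional (rotate-cotangents C) (rotate-cotangents C′)
                                     (Comparison.defect≈0⇒y+z≈y′+z′ (rotate-cotangents C) (rotate-cotangents C′)
                                       (trans (sym (defect-rotate C C′)) defect≈0)) ⟩
      C′.h * (b * b)            ≈⟨ *-congʳ h′≈ ⟩
      C.h * (r * r) * (b * b)   ≈⟨ solve 3 (λ h r b → h :* (r :* r) :* (b :* b) :=
                                     h :* (r :* b :* (r :* b))) refl C.h r b ⟩
      C.h * (r * b * (r * b))   ∎))
    where
    module C  = Cotangents C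
    module C′ = Cotangents C′
    proportional : ∀ {a b c x y z a′ b′ c′ x′ y′ z′}
      (C : Cotangents a b c x y z) (C′ : Cotangents a′ b′ c′ x′ y′ z′) →
      y + z ≈ y′ + z′ → Cotangents.h C * (a′ * a′) ≈ Cotangents.h C′ * (a * a)
    proportional {a} {b} {c} {x} {y} {z} {a′} {b′} {c′} {x′} {y′} {z′} C C′ eq = *-cancelˡ 0<2 (begin
      2# * (h * (a′ * a′))      ≈⟨ double (h * (a′ * a′)) ⟩
      h * (a′ * a′) + h * (a′ * a′)  ≈⟨ sym (distribˡ h _ _) ⟩
      h * (a′ * a′ + a′ * a′)   ≈⟨ *-congˡ (sym (Cotangents.[y+z]h C′)) ⟩
      h * (h′ * (y′ + z′))      ≈⟨ *-congˡ (*-congˡ (sym eq)) ⟩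
      h * (h′ * (y + z))
        ≈⟨ solve 3 (λ h h′ s → h :* (h′ :* s) := h′ :* (h :* s)) refl h h′ (y + z) ⟩
      h′ * (h * (y + z))        ≈⟨ *-congˡ (Cotangents.[y+z]h C) ⟩
      h′ * (a * a + a * a)      ≈⟨ distribˡ h′ _ _ ⟩
      h′ * (a * a) + h′ * (a * a) ≈⟨ sym (double (h′ * (a * a))) ⟩
      2# * (h′ * (a * a))       ∎)
      where
      h  = Cotangents.h C
      h′ = Cotangents.h C′
    h′≈ : C′.h ≈ C.h * (r * r)
    h′≈ = *-cancelˡ (*-pos C.0<a C.0<a) (begin
      a * a * C′.h              ≈⟨ *-comm (a * a) C′.h ⟩
      C′.h * (a * a)            ≈⟨ sym (proportional C C′ (Comparison.defect≈0⇒y+z≈y′+z′ C C′ defect≈0)) ⟩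
      C.h * (a′ * a′)           ≈⟨ *-congˡ (*-cong a′≈ra a′≈ra) ⟩
      C.h * (r * a * (r * a))
        ≈⟨ solve 3 (λ h r a → h :* (r :* a :* (r :* a)) := a :* a :* (h :* (r :* r))) refl C.h r a ⟩
      a * a * (C.h * (r * r))   ∎)

-- Laplacians, edge weights and cotangent sums.

module Surface {c ℓ₁ ℓ₂ ℓ₃} (ℝ : RealNumbers c ℓ₁ ℓ₂ ℓ₃) {N} (T : TriangulatedSurface N) where

  open RealNumbers ℝ
  open RealProperties ℝ
  open OrderedFieldLemmas ℝ
  open TriangleLemmas ℝ
  open TriangulatedSurface T
  open Polyhedral ℝ T
  open EuclideanMetric
  open SemiringSum (CommutativeRing.semiring commutativeRing) using
    (sum-cong-≋; *-distribʳ-sum)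

  cotTotal : EuclideanMetric → Fin N → Fin N → Carrier
  cotTotal d i j = total (incidence i j) (cotAngle d)

  -- Matching on the incidence through `with` normalises the goal, which must
  -- therefore not mention the (huge) cotangents.
  weightOf : EuclideanMetric → ∀ {i j} → Incidence (Face i j) → Carrier
  weightOf d (nonEdge _)        = 0#
  weightOf d (boundary f _)     = ½ * cotAngle d f
  weightOf d (interior f g _ _) = ½ * (cotAngle d f + cotAngle d g)

  weight≡weightOf : ∀ d i j → weight d i j ≡ weightOf d (incidence i j)
  weight≡weightOf d i j with incidence i j
  ... | nonEdge _        = ≡.refl
  ... | boundary _ _     = ≡.refl
  ... | interior _ _ _ _ = ≡.refl

  weightOf-total : ∀ d {i j} (I : Incidence (Face i j)) → weightOf d I ≈ ½ * total I (cotAngle d)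
  weightOf-total d (nonEdge _)        = sym (zeroʳ ½)
  weightOf-total d (boundary _ _)     = refl
  weightOf-total d (interior _ _ _ _) = refl

  weight-total : ∀ d i j → weight d i j ≈ ½ * cotTotal d i j
  weight-total d i j = trans (reflexive (weight≡weightOf d i j)) (weightOf-total d (incidence i j))

  faceCotangents : ∀ d {i j k} (f : Face i j k) →
    Cotangents (edgeLength d i j) (edgeLength d j k) (edgeLength d k i)
      (cotAngle d f) (cotAngle d (face-rotate f)) (cotAngle d (face-rotate (face-rotate f)))
  faceCotangents d f = cotangents (faceTriangle d f) (faceTriangle d (face-rotate f))
    (faceTriangle d (face-rotate (face-rotate f)))

  module _ (d₁ d₂ : EuclideanMetric) where

    cotAngle≈⇒weight≈ : (∀ {i j k} (f : Face i j k) → cotAngle d₁ f ≈ cotAngle d₂ f) →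
                        ∀ i j → weight d₁ i j ≈ weight d₂ i j
    cotAngle≈⇒weight≈ cot≈ i j = trans (weight-total d₁ i j)
      (trans (*-congˡ (total-cong (incidence i j) {cotAngle d₁} {cotAngle d₂} cot≈))
        (sym (weight-total d₂ i j)))

    weight≈⇒laplacian≈ : (∀ i j → weight d₁ i j ≈ weight d₂ i j) →
                         ∀ i j → laplacian d₁ i j ≈ laplacian d₂ i j
    weight≈⇒laplacian≈ w≈ i j with i ≟ j
    ... | yes _ = sum-cong-≋ {N} {weight d₁ i} {weight d₂ i} (w≈ i)
    ... | no  _ = -‿cong (w≈ i j)

    -- Diagonal entries of the Laplacian are row sums and do not display this weight. It agrees for
    -- both metrics because no face repeats a vertex.
    weight-diagonal : ∀ i → weight d₁ i i ≈ weight d₂ i i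
    weight-diagonal i = trans (weight-total d₁ i i)
      (trans (*-congˡ (total-cong (incidence i i) {cotAngle d₁} {cotAngle d₂}
          λ f → ⊥-elim (face-distinct f ≡.refl)))
        (sym (weight-total d₂ i i)))

    laplacian≈⇒weight≈ : (∀ i j → laplacian d₁ i j ≈ laplacian d₂ i j) →
                         ∀ i j → weight d₁ i j ≈ weight d₂ i j
    laplacian≈⇒weight≈ L≈ i j with i ≟ j | L≈ i j
    ... | yes ≡.refl | _   = weight-diagonal i
    ... | no  _      | -w≈ = neg-injective -w≈

    laplacian≈⇒cotTotal≈ : (∀ i j → laplacian d₁ i j ≈ laplacian d₂ i j) →
                           ∀ i j → cotTotal d₁ i j ≈ cotTotal d₂ i j
    laplacian≈⇒cotTotal≈ L≈ i j = *-cancelˡ 0<½ (trans (sym (weight-total d₁ i j))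
      (trans (laplacian≈⇒weight≈ L≈ i j) (weight-total d₂ i j)))

    edgeLengths-scaled⇒laplacian≈ : ∀ {r} → 0# < r →
      (∀ i j → Edge i j → edgeLength d₂ i j ≈ r * edgeLength d₁ i j) →
      ∀ i j → laplacian d₁ i j ≈ laplacian d₂ i j
    edgeLengths-scaled⇒laplacian≈ 0<r scaled = weight≈⇒laplacian≈ (cotAngle≈⇒weight≈ λ f →
      cot-scale (faceTriangle d₁ f) (faceTriangle d₂ f) 0<r
        (scaled _ _ (_ , f)) (scaled _ _ (_ , face-rotate f))
        (scaled _ _ (_ , face-rotate (face-rotate f))))

    -- Rigidity: vanishing of the face defects and constancy of the ratio.

    module _ (cotTotal≈ : ∀ i j → cotTotal d₁ i j ≈ cotTotal d₂ i j) where

      private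
        cotDifference : ∀ {i j k} → Face i j k → Carrier
        cotDifference f = cotAngle d₁ f - cotAngle d₂ f

        u : Fin N → Fin N → Carrier
        u i j = edgeLength d₂ i j * edgeLength d₂ i j

        term : Fin N → Fin N → Fin N → Carrier
        term i j k = spread (incidence i j) cotDifference k * u i j

        term-face : ∀ {i j k} (f : Face i j k) → term i j k ≈ cotDifference f * u i j
        term-face {i} {j} f = *-congʳ (spread-∈ (incidence i j) cotDifference
          (λ f g → +-cong (cot-irrelevant (faceTriangle d₁ f) (faceTriangle d₁ g))
            (-‿cong (cot-irrelevant (faceTriangle d₂ f) (faceTriangle d₂ g)))) f)

        term-nonFace : ∀ {i j k} → ¬ Face i j k → term i j k ≈ 0#
        term-nonFace {i} {j} ¬f = trans (*-congʳ (spread-∉ (incidence i j) cotDifference ¬f)) (zeroˡ (u i j))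

        -- For fixed `i` and `j` the squared length factors out, and the remaining sum over `k` is
        -- the difference of the two cotangent totals.
        sum-term : sum₃ term ≈ 0#
        sum-term = sum-≈0 (λ i → sum λ j → sum (term i j)) λ i → sum-≈0 (λ j → sum (term i j)) λ j → trans
          (sym (*-distribʳ-sum (u i j) (spread (incidence i j) cotDifference)))
          (trans (*-congʳ (trans (sum-spread (incidence i j) cotDifference)
            (trans (total-minus (incidence i j) (cotAngle d₁) (cotAngle d₂))
              (x≈y⇒x-y≈0 (cotTotal≈ i j)))))
            (zeroˡ (u i j)))

        -- Collects the three summands of one face into its defect. The sum over ordered triples
        -- meets a face once for each ordering of its vertices, which does no harm as only vanishing
        -- is at stake.
        cyclicTerm : Fin N → Fin N → Fin N → Carrier
        cyclicTerm i j k = term i j k + term j k i + term k i j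

        sum-cyclicTerm : sum₃ cyclicTerm ≈ 0#
        sum-cyclicTerm = trans
          (trans (sum₃-distrib-+ (λ i j k → term i j k + term j k i) (λ i j k → term k i j))
            (+-cong (trans (sum₃-distrib-+ term (λ i j k → term j k i))
                (+-cong sum-term (trans (sum₃-rotate term) sum-term)))
              (trans (sum₃-rotate (λ i j k → term j k i)) (trans (sum₃-rotate term) sum-term))))
          (trans (+-identityʳ _) (+-identityʳ 0#))

        faceDefect : ∀ {i j k} → Face i j k → Carrier
        faceDefect f = Comparison.defect (faceCotangents d₁ f) (faceCotangents d₂ f)

        cyclicTerm-face : ∀ {i j k} (f : Face i j k) → cyclicTerm i j k ≈ faceDefect f
        cyclicTerm-face f = +-cong (+-cong (term-face f) (term-face (face-rotate f)))
          (term-face (face-rotate (face-rotate f)))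

        cyclicTerm-nonNeg : ∀ {i j k} → Dec (Face i j k) → NonNegative (cyclicTerm i j k)
        cyclicTerm-nonNeg (yes f) = nonNeg-resp (sym (cyclicTerm-face f))
          (Comparison.defect-nonNeg (faceCotangents d₁ f) (faceCotangents d₂ f))
        cyclicTerm-nonNeg (no ¬f) = ≈0⇒nonNeg (trans
          (+-cong (+-cong (term-nonFace ¬f) (term-nonFace (¬f ∘ face-rotate ∘ face-rotate)))
            (term-nonFace (¬f ∘ face-rotate)))
          (trans (+-identityʳ _) (+-identityʳ 0#)))

        faceDefect≈0 : ∀ {i j k} (f : Face i j k) → faceDefect f ≈ 0#
        faceDefect≈0 f = trans (sym (cyclicTerm-face f))
          (sum₃-nonNeg-≈0 cyclicTerm (λ i j k → cyclicTerm-nonNeg (incidence⇒dec (incidence i j) k))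
            sum-cyclicTerm _ _ _)

        -- There is a vertex, and its link, being a circle or an arc, contains an edge. The edge
        -- `i₀ j₀` of the resulting face fixes the ratio.
        baseFace : ∃₂ λ i j → ∃ λ k → Face i j k
        baseFace = v , link-nonempty (link v)
          where v = fromℕ< (>-nonZero⁻¹ N {{nonempty}})

        i₀ j₀ : Fin N
        i₀ = proj₁ baseFace
        j₀ = proj₁ (proj₂ baseFace)

        e₀ : Edge i₀ j₀
        e₀ = proj₂ (proj₂ baseFace)

      ratio : Carrier
      ratio = edgeLength d₂ i₀ j₀ * recip (positive d₁ e₀)

      ratio-pos : 0# < ratio
      ratio-pos = *-pos (positive d₂ e₀) (recip-pos (positive d₁ e₀))

      private
        Scaled : Fin N → Fin N → Set ℓ₁
        Scaled i j = edgeLength d₂ i j ≈ ratio * edgeLength d₁ i j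

        scaled-symmetric : ∀ {i j} → Edge i j → Scaled i j → Scaled j i
        scaled-symmetric e s = trans (sym (symmetric d₂ e)) (trans s (*-congˡ (symmetric d₁ e)))

        scaled-face : ∀ {i j k} → Face i j k → Scaled i j → Scaled j k
        scaled-face f = similar (faceCotangents d₁ f) (faceCotangents d₂ f) (faceDefect≈0 f) ratio-pos

        -- The scaling passes along the sides of the face from `v x` to `x y` to `y v`. In this form
        -- it is a step along an edge of the link of `v`.
        scaled-link : ∀ {v x y} → Face v x y → Scaled v x → Scaled v y
        scaled-link f s = scaled-symmetric (_ , face-rotate (face-rotate f))
          (scaled-face (face-rotate f) (scaled-face f s))

        scaled-vertex : ∀ {v x y} → Edge v x → Edge v y → Scaled v x → Scaled v y
        scaled-vertex {v} (_ , f) (_ , g) = link-connected (link v) scaled-link f g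

        -- The invariant along the path is that all edges at the current vertex are scaled. The edge
        -- just traversed carries it to the next vertex, and connectedness of the link there spreads
        -- it to all edges at that vertex.
        scaled-star : ∀ {v w} → Star Edge v w → (∀ {x} → Edge v x → Scaled v x) →
                      ∀ {x} → Edge w x → Scaled w x
        scaled-star ε                 s = s
        scaled-star (e@(_ , f) ◅ es) s = scaled-star es λ e′ →
          scaled-vertex (_ , face-swap f) e′ (scaled-symmetric e (s e))

      edgeLengths-scaled : ∀ i j → Edge i j → edgeLength d₂ i j ≈ ratio * edgeLength d₁ i j
      edgeLengths-scaled i j = scaled-star (connected i₀ i)
        -- The base edge is scaled by the choice of `ratio`, and then so is every edge at `i₀`.
        λ e → scaled-vertex e₀ e (sym (*-recip-* (edgeLength d₂ i₀ j₀) (positive d₁ e₀)))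

mainTheorem1 : ∀ {r ℓ₁ ℓ₂ ℓ₃} (ℝ : RealNumbers r ℓ₁ ℓ₂ ℓ₃) {N : ℕ} (T : TriangulatedSurface N)
    (let open RealNumbers ℝ) (let open TriangulatedSurface T)
    (let open Polyhedral ℝ T) (let open EuclideanMetric)
    (d₁ d₂ : EuclideanMetric) →
    (∀ i j → laplacian d₁ i j ≈ laplacian d₂ i j) ⇔
    (∃ λ c → 0# < c × (∀ i j → Edge i j → edgeLength d₂ i j ≈ c * edgeLength d₁ i j))
mainTheorem1 ℝ T d₁ d₂ = mk⇔
  (λ L≈ → let cotTotal≈ = laplacian≈⇒cotTotal≈ d₁ d₂ L≈ in
    ratio d₁ d₂ cotTotal≈ , ratio-pos d₁ d₂ cotTotal≈ , edgeLengths-scaled d₁ d₂ cotTotal≈)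
  (λ (_ , 0<c , scaled) → edgeLengths-scaled⇒laplacian≈ d₁ d₂ 0<c scaled)
  where open Surface ℝ T
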